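{- For all $\delta,\delta'\in\{\mathbf{CInd},\mathbf{T}\}$ and $\mathcal{C}\in\{\mathcal{R},\mathcal{P}\}$ we have $[\tau(\delta')\mathcal{C}\mathbf{Txt}\mathbf{It}\delta\mathbf{Ex}_C]_{\mathbf{REC}} \subseteq [\tau(\delta')\mathcal{C}\mathbf{Txt}\mathbf{Sd}\delta\mathbf{Ex}_C]_{\mathbf{REC}}$.
   Context: Fix an acceptable numbering $(\varphi_e)_{e\in\mathbb{N}}$ of all partial computable functions. A number $e$ is a $C$-index if $\varphi_e$ is total with values in $\{0,1\}$; then $C_e=\{x:\varphi_e(x)=1\}$. $\mathbf{REC}$ is the collection of recursive subsets of $\mathbb{N}$; $\mathcal{P}$ and $\mathcal{R}$ are the partial computable and total computable functions. Fix a pause symbol $\#$. A text is a total function $T:\mathbb{N}\to\mathbb{N}\cup\{\#\}$, $\mathrm{content}(T)=\mathrm{range}(T)\setminus\{\#\}$, $T$ is a text for $L$ if $\mathrm{content}(T)=L$, $T[n]=(T(0),\dots,T(n-1))$, and content of finite sequences is defined likewise. A learner is some $h\in\mathcal{P}$ (finite sequences/sets coded as numbers). Hypothesis sequences: set-driven $\mathbf{Sd}(h,T)(i)=h(\mathrm{content}(T[i]))$; iterative $\mathbf{It}(h,T)(0)=h(\varepsilon)$ ($\varepsilon$ the empty sequence) and $\mathbf{It}(h,T)(i)=h(\mathbf{It}(h,T)(i-1),T(i-1))$ for $i>0$. Restrictions on a hypothesis sequence $p$ and text $T$: $\mathbf{Ex}_C$: there is $n_0$ with $p(n)=p(n_0)$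 for all $n\ge n_0$ and $p(n_0)$ a $C$-index with $C_{p(n_0)}=\mathrm{content}(T)$; $\mathbf{CInd}$: for all $i$, $p(i)$ is a $C$-index; $\mathbf{T}$: always true. Juxtaposition of restrictions means conjunction. For $\mathcal{C}\in\{\mathcal{P},\mathcal{R}\}$, a learner $h\in\mathcal{C}$ $\tau(\alpha)\mathcal{C}\mathbf{Txt}\beta\delta$-learns $L$ iff $\alpha(\beta(h,T),T)$ holds for every text $T$ whatsoever and $\delta(\beta(h,T),T)$ holds for every text $T$ for $L$. $[\tau(\alpha)\mathcal{C}\mathbf{Txt}\beta\delta]_{\mathbf{REC}}$ is the set of all classes $\mathcal{L}\subseteq\mathbf{REC}$ for which some $h\in\mathcal{C}$ learns every $L\in\mathcal{L}$ in this sense. -}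

module Defs where

open import Data.Nat using (ℕ; zero; suc; _+_; _^_; _<_; _≤_; _⊔_; _≟_)
open import Data.Maybe using (Maybe; just; nothing)
open import Data.List using (List; []; _∷_; catMaybes; foldr)
open import Data.List.Membership.DecPropositional _≟_ using (_∈?_)
open import Data.Product using (Σ; ∃; _×_; _,_)
open import Data.Unit using (⊤)
open import Relation.Binary.PropositionalEquality using (_≡_)
open import Relation.Nullary using (does)
open import Data.Bool using (if_then_else_)

-- Cantor pairing  ⟨x,y⟩ = (x+y)(x+y+1)/2 + y   (a bijection ℕ×ℕ → ℕ)

tri : ℕ → ℕ
tri zero    = zero
tri (suc n) = suc n + tri n

pair : ℕ → ℕ → ℕ
pair x y = tri (x + y) + y

-- Partial recursive functions ℕ ⇀ ℕ (unary, arguments tupled by Cantor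
-- pairing).  Basis: zero, successor, identity, the two unpairing
-- projections; closed under composition, pairing, primitive recursion
-- (with a parameter) and unbounded minimisation.

data Code : Set where
  zeroC succC idC fstC sndC : Code
  compC pairC recC : Code → Code → Code
  muC  : Code → Code

data Eval : Code → ℕ → ℕ → Set where
  ev-zero : ∀ x → Eval zeroC x 0
  ev-succ : ∀ x → Eval succC x (suc x)
  ev-id   : ∀ x → Eval idC x x
  ev-fst  : ∀ y z → Eval fstC (pair y z) y
  ev-snd  : ∀ y z → Eval sndC (pair y z) z
  ev-comp : ∀ {f g x u v} → Eval g x u → Eval f u v → Eval (compC f g) x v
  ev-pair : ∀ {f g x u v} → Eval f x u → Eval g x v → Eval (pairC f g) x (pair u v)
  ev-rec0 : ∀ {f g x v} → Eval f x v → Eval (recC f g) (pair x 0) v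
  ev-recS : ∀ {f g x n u v} → Eval (recC f g) (pair x n) u →
            Eval g (pair x (pair n u)) v → Eval (recC f g) (pair x (suc n)) v
  ev-mu   : ∀ {f x n} → Eval f (pair x n) 0 →
            (∀ m → m < n → ∃ λ k → Eval f (pair x m) (suc k)) →
            Eval (muC f) x n

encode : Code → ℕ
encode zeroC       = pair 0 0
encode succC       = pair 1 0
encode idC         = pair 2 0
encode fstC        = pair 3 0
encode sndC        = pair 4 0
encode (compC f g) = pair 5 (pair (encode f) (encode g))
encode (pairC f g) = pair 6 (pair (encode f) (encode g))
encode (recC f g)  = pair 7 (pair (encode f) (encode g))
encode (muC f)     = pair 8 (encode f)

-- The numbering φ: φ_e(x) ↓= y.  Numbers that are not codes of any
-- program index the nowhere-defined function.
φ : ℕ → ℕ → ℕ → Set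
φ e x y = Σ Code λ c → encode c ≡ e × Eval c x y

CIndex : ℕ → Set
CIndex e = ∀ x → ∃ λ y → φ e x y × y ≤ 1

Lang : Set₁
Lang = ℕ → Set

C : ℕ → Lang
C e x = φ e x 1

SameLang : Lang → Lang → Set
SameLang L L' = ∀ x → (L x → L' x) × (L' x → L x)

Recursive : Lang → Set
Recursive L = Σ ℕ λ e → CIndex e × SameLang (C e) L

-- Texts: nothing plays the role of the pause symbol #.

Text : Set
Text = ℕ → Maybe ℕ

content : Text → Lang
content T x = ∃ λ i → T i ≡ just x

TextFor : Text → Lang → Set
TextFor T L = SameLang (content T) L

prefix : Text → ℕ → List (Maybe ℕ)
prefix T zero    = []
prefix T (suc n) = foldr _∷_ (T n ∷ []) (prefix T n)

codeSym : Maybe ℕ → ℕ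
codeSym nothing  = 0
codeSym (just n) = suc n

-- Canonical code of a finite set D:  Σ_{x ∈ D} 2^x
bound : List ℕ → ℕ
bound = foldr (λ x m → suc x ⊔ m) 0

setCodeBelow : List ℕ → ℕ → ℕ
setCodeBelow l zero    = 0
setCodeBelow l (suc n) =
  (if does (n ∈? l) then 2 ^ n else 0) + setCodeBelow l n

setCode : List ℕ → ℕ
setCode l = setCodeBelow l (bound l)

-- Hypothesis sequences (partial: HSeq p  with  p i v  meaning p(i) ↓= v).

HSeq : Set₁
HSeq = ℕ → ℕ → Set

Sd : Code → Text → HSeq
Sd h T i v = Eval h (setCode (catMaybes (prefix T i))) v

-- iterative:  It(h,T)(0) = h(ε),  It(h,T)(i+1) = h(It(h,T)(i), T(i)).
-- Input coding: ε ↦ 0,  (p , x) ↦ 1 + ⟨p , code x⟩.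
It : Code → Text → HSeq
It h T zero    v = Eval h 0 v
It h T (suc i) v = ∃ λ u → It h T i u × Eval h (suc (pair u (codeSym (T i)))) v

ExC : HSeq → Text → Set
ExC p T = Σ ℕ λ n₀ → Σ ℕ λ e →
  (∀ n → n₀ ≤ n → p n e) × CIndex e × SameLang (C e) (content T)

data Restr : Set where
  CInd Tr : Restr

holds : Restr → HSeq → Text → Set
holds CInd p T = ∀ i → ∃ λ e → p i e × CIndex e
holds Tr   p T = ⊤

data LClass : Set where
  𝓡 𝓟 : LClass

InLClass : LClass → Code → Set
InLClass 𝓡 h = ∀ x → ∃ λ y → Eval h x y
InLClass 𝓟 h = ⊤

-- h  τ(α) Txt β δ Ex_C -learns L  (membership h ∈ 𝓒 is required separately)
Learns : Restr → (Code → Text → HSeq) → Restr → Code → Lang → Set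
Learns α β δ h L =
  (∀ T → holds α (β h T) T) ×
  (∀ T → TextFor T L → holds δ (β h T) T × ExC (β h T) T)

InLearnable : Restr → LClass → (Code → Text → HSeq) → Restr → (Lang → Set) → Set₁
InLearnable α 𝓒 β δ 𝓛 =
  (∀ L → 𝓛 L → Recursive L) ×
  Σ Code λ h → InLClass 𝓒 h × (∀ L → 𝓛 L → Learns α β δ h L)

{-# OPTIONS --safe #-}
-- An iterative learner h that has converged to e on a text for L is left in e
-- by every later element of L.  Feed h the elements of a finite set D in
-- increasing order, each place followed by a pause, and let c be the place from
-- which its hypothesis s no longer changes.  If D is large enough inside L, then
-- c and ε = D ∩ [0,c) depend on L only.  The set-driven learner outputs an index
-- of the program that on argument y reruns h on the set ε, finds s and c again,
-- and answers φ_s(y) if c ≤ y and "y ∈ ε?" if y < c.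
--
-- Outputting s itself would need a case distinction on whether L is finite: on
-- a small D the hypothesis s may still be in motion, and whether L has further
-- elements is undecidable.  Rerunning h inside the conjectured program, with a
-- universal program for φ_s, makes the conjecture the same in both cases.
module Submission where

open import Defs
open import Data.Bool using (if_then_else_)
open import Data.List using (List; []; _∷_; _++_; catMaybes)
open import Data.List.Membership.Propositional using (_∈_)
open import Data.List.Membership.Propositional.Properties using (∈-++⁺ˡ; ∈-++⁺ʳ; ∈-++⁻)
open import Data.List.Properties using (++-is-foldr; catMaybes-++)
open import Data.List.Relation.Unary.All using (All; []; _∷_)
open import Data.List.Relation.Unary.Any using (here; there)
open import Data.Maybe using (Maybe; just; nothing)
open import Data.Nat
open import Data.List.Membership.DecPropositional _≟_ using (_∈?_)
open import Data.Nat.Properties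
open import Data.Product using (Σ; ∃; ∃-syntax; _×_; _,_; proj₁; proj₂)
open import Data.Sum using (_⊎_; inj₁; inj₂)
open import Function using (_∘_)
open import Relation.Binary.Definitions using (tri<; tri≈; tri>)
open import Relation.Binary.PropositionalEquality
open import Relation.Nullary using (¬_; does; yes; no; contradiction)

-- Pairing and determinism

-- The successor along the antidiagonals, in the order in which `pair` counts. Iterating it inverts
-- `pair` without square roots.
next : ℕ × ℕ → ℕ × ℕ
next (zero  , y) = suc y , 0
next (suc x , y) = x , suc y

pair-next : ∀ p → pair (proj₁ (next p)) (proj₂ (next p)) ≡ suc (pair (proj₁ p) (proj₂ p))
pair-next (zero , y) rewrite +-identityʳ y | +-identityʳ (y + tri y) =
  cong suc (+-comm y (tri y))
pair-next (suc x , y) rewrite +-suc x y = +-suc _ y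

unpair : ℕ → ℕ × ℕ
unpair zero    = 0 , 0
unpair (suc n) = next (unpair n)

pair-unpair : ∀ n → pair (proj₁ (unpair n)) (proj₂ (unpair n)) ≡ n
pair-unpair zero    = refl
pair-unpair (suc n) = trans (pair-next (unpair n)) (cong suc (pair-unpair n))

-- Induction on the code: every pair except (0 , 0) is `next` of another pair, whose code is one
-- smaller by `pair-next`.
unpair-unique : ∀ n x y → pair x y ≡ n → unpair n ≡ (x , y)
unpair-unique zero    zero    zero    eq = refl
unpair-unique (suc n) (suc x) zero    eq =
  cong next (unpair-unique n 0 x (suc-injective (trans (sym (pair-next (0 , x))) eq)))
unpair-unique (suc n) x       (suc y) eq =
  cong next (unpair-unique n (suc x) y (suc-injective (trans (sym (pair-next (suc x , y))) eq)))

n≤tri : ∀ n → n ≤ tri n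
n≤tri zero    = z≤n
n≤tri (suc n) = m≤m+n (suc n) (tri n)

-- An opaque copy of the pairing keeps Agda from unfolding the triangular
-- numbers in pairs with a literal component.
opaque
  ⟪_,_⟫ : ℕ → ℕ → ℕ
  ⟪ x , y ⟫ = pair x y

  π₁ π₂ : ℕ → ℕ
  π₁ n = proj₁ (unpair n)
  π₂ n = proj₂ (unpair n)

  pair≡⟪⟫ : ∀ x y → pair x y ≡ ⟪ x , y ⟫
  pair≡⟪⟫ x y = refl

  π₁-⟪⟫ : ∀ x y → π₁ ⟪ x , y ⟫ ≡ x
  π₁-⟪⟫ x y = cong proj₁ (unpair-unique _ x y refl)

  π₂-⟪⟫ : ∀ x y → π₂ ⟪ x , y ⟫ ≡ y
  π₂-⟪⟫ x y = cong proj₂ (unpair-unique _ x y refl)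

  ⟪⟫-η : ∀ n → ⟪ π₁ n , π₂ n ⟫ ≡ n
  ⟪⟫-η = pair-unpair

  x≤⟪x,y⟫ : ∀ x y → x ≤ ⟪ x , y ⟫
  x≤⟪x,y⟫ x y = ≤-trans (m≤m+n x y) (≤-trans (n≤tri (x + y)) (m≤m+n _ y))

  y≤⟪x,y⟫ : ∀ x y → y ≤ ⟪ x , y ⟫
  y≤⟪x,y⟫ x y = m≤n+m y _

pair-injective : ∀ x y x′ y′ → pair x y ≡ pair x′ y′ → x ≡ x′ × y ≡ y′
pair-injective x y x′ y′ eq with trans (sym (unpair-unique _ x y eq)) (unpair-unique _ x′ y′ refl)
... | refl = refl , refl

-- The two arguments are joined by an equation because `pair x n` is not a constructor form:
-- `pair-injective` then does what unification cannot. For `muC`, the smaller of two distinct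
-- results would give both zero and a successor.
Eval-det : ∀ {c x x′ v v′} → x ≡ x′ → Eval c x v → Eval c x′ v′ → v ≡ v′
Eval-det eq (ev-zero _)   (ev-zero _)     = refl
Eval-det eq (ev-succ _)   (ev-succ _)     = cong suc eq
Eval-det eq (ev-id _)     (ev-id _)       = eq
Eval-det eq (ev-fst y z)  (ev-fst y′ z′)  = proj₁ (pair-injective y z y′ z′ eq)
Eval-det eq (ev-snd y z)  (ev-snd y′ z′)  = proj₂ (pair-injective y z y′ z′ eq)
Eval-det eq (ev-comp d e) (ev-comp d′ e′) = Eval-det (Eval-det eq d d′) e e′
Eval-det eq (ev-pair d e) (ev-pair d′ e′) = cong₂ pair (Eval-det eq d d′) (Eval-det eq e e′)
Eval-det eq (ev-rec0 {x = x} d) (ev-rec0 {x = x′} d′) =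
  Eval-det (proj₁ (pair-injective x 0 x′ 0 eq)) d d′
Eval-det eq (ev-rec0 {x = x} _) (ev-recS {x = x′} {n = n′} _ _)
  with () ← proj₂ (pair-injective x 0 x′ (suc n′) eq)
Eval-det eq (ev-recS {x = x} {n = n} _ _) (ev-rec0 {x = x′} _)
  with () ← proj₂ (pair-injective x (suc n) x′ 0 eq)
Eval-det eq (ev-recS {x = x} {n = n} d e) (ev-recS {x = x′} {n = n′} d′ e′)
  with refl , refl ← pair-injective x (suc n) x′ (suc n′) eq
  with refl ← Eval-det refl d d′ = Eval-det refl e e′
Eval-det refl (ev-mu {n = n} d f) (ev-mu {n = n′} d′ f′) with <-cmp n n′
... | tri≈ _ n≡n′ _ = n≡n′
... | tri< n<n′ _ _ with () ← Eval-det refl d (proj₂ (f′ n n<n′))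
... | tri> _ _ n′<n with () ← Eval-det refl (proj₂ (f n′ n′<n)) d′

-- Every program code is a pair of `tag` and `args`. Distinct constructors have distinct literal
-- tags, so the mixed cases of injectivity are absurd on sight.
tag : Code → ℕ
tag zeroC       = 0
tag succC       = 1
tag idC         = 2
tag fstC        = 3
tag sndC        = 4
tag (compC _ _) = 5
tag (pairC _ _) = 6
tag (recC _ _)  = 7
tag (muC _)     = 8

args : Code → ℕ
args (compC f g) = pair (encode f) (encode g)
args (pairC f g) = pair (encode f) (encode g)
args (recC f g)  = pair (encode f) (encode g)
args (muC f)     = encode f
args _           = 0

encode≡ : ∀ c → encode c ≡ pair (tag c) (args c)
encode≡ zeroC       = refl
encode≡ succC       = refl
encode≡ idC         = refl
encode≡ fstC        = refl
encode≡ sndC        = refl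
encode≡ (compC _ _) = refl
encode≡ (pairC _ _) = refl
encode≡ (recC _ _)  = refl
encode≡ (muC _)     = refl

mutual
  encode-injective : ∀ c c′ → encode c ≡ encode c′ → c ≡ c′
  encode-injective c c′ eq =
    let t , a = pair-injective (tag c) (args c) (tag c′) (args c′)
                  (trans (sym (encode≡ c)) (trans eq (encode≡ c′)))
    in tag-args-injective c c′ t a

  tag-args-injective : ∀ c c′ → tag c ≡ tag c′ → args c ≡ args c′ → c ≡ c′
  tag-args-injective zeroC zeroC _ _ = refl
  tag-args-injective succC succC _ _ = refl
  tag-args-injective idC   idC   _ _ = refl
  tag-args-injective fstC  fstC  _ _ = refl
  tag-args-injective sndC  sndC  _ _ = refl
  tag-args-injective (compC f g) (compC f′ g′) _ eq
    with pair-injective (encode f) (encode g) (encode f′) (encode g′) eq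
  ... | p , q = cong₂ compC (encode-injective f f′ p) (encode-injective g g′ q)
  tag-args-injective (pairC f g) (pairC f′ g′) _ eq
    with pair-injective (encode f) (encode g) (encode f′) (encode g′) eq
  ... | p , q = cong₂ pairC (encode-injective f f′ p) (encode-injective g g′ q)
  tag-args-injective (recC f g)  (recC f′ g′)  _ eq
    with pair-injective (encode f) (encode g) (encode f′) (encode g′) eq
  ... | p , q = cong₂ recC (encode-injective f f′ p) (encode-injective g g′ q)
  tag-args-injective (muC f)     (muC f′)      _ eq = cong muC (encode-injective f f′ eq)

φ-det : ∀ {e x v v′} → φ e x v → φ e x v′ → v ≡ v′
φ-det (c , p , d) (c′ , p′ , d′) with encode-injective c c′ (trans p (sym p′))
... | refl = Eval-det refl d d′

-- Computable total functions

Computable : (ℕ → ℕ) → Set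
Computable f = Σ Code λ c → ∀ x → Eval c x (f x)

ev-⟪⟫ : ∀ {f g x u v} → Eval f x u → Eval g x v → Eval (pairC f g) x ⟪ u , v ⟫
ev-⟪⟫ d e = subst (Eval _ _) (pair≡⟪⟫ _ _) (ev-pair d e)

ev-π₁ : ∀ x → Eval fstC x (π₁ x)
ev-π₁ x = subst (λ z → Eval fstC z (π₁ x)) (trans (pair≡⟪⟫ _ _) (⟪⟫-η x)) (ev-fst (π₁ x) (π₂ x))

ev-π₂ : ∀ x → Eval sndC x (π₂ x)
ev-π₂ x = subst (λ z → Eval sndC z (π₂ x)) (trans (pair≡⟪⟫ _ _) (⟪⟫-η x)) (ev-snd (π₁ x) (π₂ x))

ev-rec-zero : ∀ {f g x v} → Eval f x v → Eval (recC f g) ⟪ x , 0 ⟫ v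
ev-rec-zero {x = x} d = subst (λ z → Eval _ z _) (pair≡⟪⟫ x 0) (ev-rec0 d)

ev-rec-suc : ∀ {f g x n u v} → Eval (recC f g) ⟪ x , n ⟫ u →
             Eval g ⟪ x , ⟪ n , u ⟫ ⟫ v → Eval (recC f g) ⟪ x , suc n ⟫ v
ev-rec-suc {f} {g} {x} {n} {u} d e = subst (λ z → Eval _ z _) (pair≡⟪⟫ x (suc n))
  (ev-recS {x = x} {n} {u}
    (subst (λ z → Eval (recC f g) z u) (sym (pair≡⟪⟫ x n)) d)
    (subst (λ z → Eval g z _)
      (sym (trans (cong (pair x) (pair≡⟪⟫ n u)) (pair≡⟪⟫ x ⟪ n , u ⟫))) e))

comp-cong : ∀ {f g : ℕ → ℕ} → (∀ x → f x ≡ g x) → Computable f → Computable g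
comp-cong eq (c , d) = c , λ x → subst (Eval c x) (eq x) (d x)

infixr 9 _∘ᶜ_
_∘ᶜ_ : ∀ {f g} → Computable f → Computable g → Computable (f ∘ g)
(c , d) ∘ᶜ (c′ , d′) = compC c c′ , λ x → ev-comp (d′ x) (d _)

idᶜ : Computable (λ x → x)
idᶜ = idC , ev-id

sucᶜ : ∀ {f} → Computable f → Computable (λ x → suc (f x))
sucᶜ F = (succC , ev-succ) ∘ᶜ F

fstᶜ : ∀ {f} → Computable f → Computable (λ x → π₁ (f x))
fstᶜ F = (fstC , ev-π₁) ∘ᶜ F

sndᶜ : ∀ {f} → Computable f → Computable (λ x → π₂ (f x))
sndᶜ F = (sndC , ev-π₂) ∘ᶜ F

⟪_,_⟫ᶜ : ∀ {f g} → Computable f → Computable g → Computable (λ x → ⟪ f x , g x ⟫)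
⟪ (c , d) , (c′ , d′) ⟫ᶜ = pairC c c′ , λ x → ev-⟪⟫ (d x) (d′ x)

numeral : ℕ → Code
numeral zero    = zeroC
numeral (suc n) = compC succC (numeral n)

ev-numeral : ∀ n x → Eval (numeral n) x n
ev-numeral zero    x = ev-zero x
ev-numeral (suc n) x = ev-comp (ev-numeral n x) (ev-succ n)

constᶜ : ∀ n → Computable (λ _ → n)
constᶜ n = numeral n , ev-numeral n

natrec : ℕ → (ℕ → ℕ → ℕ) → ℕ → ℕ
natrec a g zero    = a
natrec a g (suc n) = g n (natrec a g n)

-- The nesting is that of the argument which `ev-recS` passes to the step program.
uncurry₃ : (ℕ → ℕ → ℕ → ℕ) → ℕ → ℕ
uncurry₃ g z = g (π₁ z) (π₁ (π₂ z)) (π₂ (π₂ z))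

uncurry₃-⟪⟫ : ∀ g x y z → uncurry₃ g ⟪ x , ⟪ y , z ⟫ ⟫ ≡ g x y z
uncurry₃-⟪⟫ g x y z
  rewrite π₁-⟪⟫ x ⟪ y , z ⟫ | π₂-⟪⟫ x ⟪ y , z ⟫ | π₁-⟪⟫ y z | π₂-⟪⟫ y z = refl

-- The step function also receives the argument x, as a parameter.
recᶜ : ∀ {a k} {g : ℕ → ℕ → ℕ → ℕ} → Computable a →
       Computable (uncurry₃ g) → Computable k →
       Computable (λ x → natrec (a x) (g x) (k x))
recᶜ {a} {k} {g} (A , dA) (G , dG) (K , dK) =
  compC (recC A G) (pairC idC K) , λ x → ev-comp (ev-⟪⟫ (ev-id x) (dK x)) (go x (k x))
  where
  go : ∀ x n → Eval (recC A G) ⟪ x , n ⟫ (natrec (a x) (g x) n)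
  go x zero    = ev-rec-zero (dA x)
  go x (suc n) = ev-rec-suc (go x n) (subst (Eval G _) (uncurry₃-⟪⟫ g x n _) (dG _))

-- Polymorphic, since the same test also selects symbols (`cell`) and programs (`answer`).
ifz : {A : Set} → ℕ → A → A → A
ifz zero    a b = a
ifz (suc _) a b = b

ifzᶜ : ∀ {f g h} → Computable f → Computable g → Computable h →
       Computable (λ x → ifz (f x) (g x) (h x))
ifzᶜ {f} {g} {h} F G H =
  comp-cong (λ x → eq (f x) x) (recᶜ {g = λ x _ _ → h x} G (H ∘ᶜ fstᶜ idᶜ) F)
  where
  eq : ∀ n x → natrec (g x) (λ _ _ → h x) n ≡ ifz n (g x) (h x)
  eq zero    x = refl
  eq (suc n) x = refl

predᶜ : ∀ {f} → Computable f → Computable (λ x → pred (f x))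
predᶜ {f} F = comp-cong (λ x → eq (f x))
  (recᶜ {g = λ _ n _ → n} (constᶜ 0) (fstᶜ (sndᶜ idᶜ)) F)
  where
  eq : ∀ n → natrec 0 (λ n _ → n) n ≡ pred n
  eq zero    = refl
  eq (suc n) = refl

∸ᶜ : ∀ {f g} → Computable f → Computable g → Computable (λ x → f x ∸ g x)
∸ᶜ {f} {g} F G = comp-cong (λ x → eq (f x) (g x))
  (recᶜ {g = λ _ _ u → pred u} F (predᶜ (sndᶜ (sndᶜ idᶜ))) G)
  where
  eq : ∀ m n → natrec m (λ _ u → pred u) n ≡ m ∸ n
  eq m zero    = refl
  eq m (suc n) = trans (cong pred (eq m n)) (pred[m∸n]≡m∸[1+n] m n)

+ᶜ : ∀ {f g} → Computable f → Computable g → Computable (λ x → f x + g x)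
+ᶜ {f} {g} F G = comp-cong (λ x → eq (f x) (g x))
  (recᶜ {g = λ _ _ u → suc u} G (sucᶜ (sndᶜ (sndᶜ idᶜ))) F)
  where
  eq : ∀ m n → natrec n (λ _ u → suc u) m ≡ m + n
  eq zero    n = refl
  eq (suc m) n = cong suc (eq m n)

-- Binary digits

-- Remainder and quotient modulo 2, in the shape of primitive recursions.
lowBit half : ℕ → ℕ
lowBit zero    = 0
lowBit (suc n) = 1 ∸ lowBit n
half zero    = 0
half (suc n) = lowBit n + half n

shift : ℕ → ℕ → ℕ
shift d zero    = d
shift d (suc n) = half (shift d n)

bit : ℕ → ℕ → ℕ
bit d n = lowBit (shift d n)

-- Built like `setCodeBelow`, so that canonical set codes are instances. Any non-zero value of `b`
-- counts as the digit 1.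
binary : (ℕ → ℕ) → ℕ → ℕ
binary b zero    = 0
binary b (suc n) = ifz (b n) 0 (2 ^ n) + binary b n

lowBitᶜ : ∀ {f} → Computable f → Computable (λ x → lowBit (f x))
lowBitᶜ {f} F = comp-cong (λ x → eq (f x))
  (recᶜ {g = λ _ _ u → 1 ∸ u} (constᶜ 0) (∸ᶜ (constᶜ 1) (sndᶜ (sndᶜ idᶜ))) F)
  where
  eq : ∀ n → natrec 0 (λ _ u → 1 ∸ u) n ≡ lowBit n
  eq zero    = refl
  eq (suc n) = cong (1 ∸_) (eq n)

halfᶜ : ∀ {f} → Computable f → Computable (λ x → half (f x))
halfᶜ {f} F = comp-cong (λ x → eq (f x))
  (recᶜ {g = λ _ n u → lowBit n + u} (constᶜ 0)
    (+ᶜ (lowBitᶜ (fstᶜ (sndᶜ idᶜ))) (sndᶜ (sndᶜ idᶜ))) F)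
  where
  eq : ∀ n → natrec 0 (λ n u → lowBit n + u) n ≡ half n
  eq zero    = refl
  eq (suc n) = cong (lowBit n +_) (eq n)

bitᶜ : ∀ {f g} → Computable f → Computable g → Computable (λ x → bit (f x) (g x))
bitᶜ {f} {g} F G = lowBitᶜ (comp-cong (λ x → eq (f x) (g x))
  (recᶜ {g = λ _ _ u → half u} F (halfᶜ (sndᶜ (sndᶜ idᶜ))) G))
  where
  eq : ∀ d n → natrec d (λ _ u → half u) n ≡ shift d n
  eq d zero    = refl
  eq d (suc n) = cong half (eq d n)

2^ᶜ : ∀ {f} → Computable f → Computable (λ x → 2 ^ f x)
2^ᶜ {f} F = comp-cong (λ x → eq (f x))
  (recᶜ {g = λ _ _ u → u + (u + 0)} (constᶜ 1)
    (+ᶜ (sndᶜ (sndᶜ idᶜ)) (+ᶜ (sndᶜ (sndᶜ idᶜ)) (constᶜ 0))) F)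
  where
  eq : ∀ n → natrec 1 (λ _ u → u + (u + 0)) n ≡ 2 ^ n
  eq zero    = refl
  eq (suc n) = cong (λ u → u + (u + 0)) (eq n)

truncateᶜ : ∀ {f g} → Computable f → Computable g →
            Computable (λ x → binary (bit (f x)) (g x))
truncateᶜ {f} {g} F G = comp-cong (λ x → eq (f x) (g x))
  (recᶜ {g = λ x n u → ifz (bit (f x) n) 0 (2 ^ n) + u} (constᶜ 0)
    (+ᶜ (ifzᶜ (bitᶜ (F ∘ᶜ fstᶜ idᶜ) n) (constᶜ 0) (2^ᶜ n)) (sndᶜ (sndᶜ idᶜ))) G)
  where
  n = fstᶜ (sndᶜ idᶜ)
  eq : ∀ d n → natrec 0 (λ n u → ifz (bit d n) 0 (2 ^ n) + u) n ≡ binary (bit d) n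
  eq d zero    = refl
  eq d (suc n) = cong (ifz (bit d n) 0 (2 ^ n) +_) (eq d n)

lowBit-2* : ∀ m → lowBit (2 * m) ≡ 0
lowBit-2* zero    = refl
lowBit-2* (suc m) rewrite +-suc m (m + 0) | lowBit-2* m = refl

half-2* : ∀ m → half (2 * m) ≡ m
half-2* zero    = refl
half-2* (suc m) rewrite +-suc m (m + 0) | lowBit-2* m = cong suc (half-2* m)

shift-half : ∀ d n → shift (half d) n ≡ shift d (suc n)
shift-half d zero    = refl
shift-half d (suc n) = cong half (shift-half d n)

-- `binary` adds digits at the high end, while `lowBit` and `half` remove them at the low end; this
-- equation mediates between the two.
binary-low : ∀ b n → binary b (suc n) ≡ ifz (b 0) 0 1 + 2 * binary (b ∘ suc) n
binary-low b zero    = refl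
binary-low b (suc n) = begin
  ifz (b (suc n)) 0 (2 ^ suc n) + binary b (suc n)
    ≡⟨ cong₂ _+_ (double-ifz (b (suc n))) (binary-low b n) ⟩
  2 * w + (ifz (b 0) 0 1 + 2 * binary (b ∘ suc) n)
    ≡⟨ sym (+-assoc (2 * w) _ _) ⟩
  2 * w + ifz (b 0) 0 1 + 2 * binary (b ∘ suc) n
    ≡⟨ cong (_+ 2 * binary (b ∘ suc) n) (+-comm (2 * w) _) ⟩
  ifz (b 0) 0 1 + 2 * w + 2 * binary (b ∘ suc) n
    ≡⟨ +-assoc (ifz (b 0) 0 1) _ _ ⟩
  ifz (b 0) 0 1 + (2 * w + 2 * binary (b ∘ suc) n)
    ≡⟨ cong (ifz (b 0) 0 1 +_) (sym (*-distribˡ-+ 2 w _)) ⟩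
  ifz (b 0) 0 1 + 2 * (w + binary (b ∘ suc) n) ∎
  where
  open ≡-Reasoning
  w = ifz (b (suc n)) 0 (2 ^ n)
  double-ifz : ∀ k → ifz k 0 (2 ^ suc n) ≡ 2 * ifz k 0 (2 ^ n)
  double-ifz zero    = refl
  double-ifz (suc _) = refl

lowBit-digit : ∀ k m → lowBit (ifz k 0 1 + 2 * m) ≡ ifz k 0 1
lowBit-digit zero    m = lowBit-2* m
lowBit-digit (suc _) m = cong (1 ∸_) (lowBit-2* m)

half-digit : ∀ k m → half (ifz k 0 1 + 2 * m) ≡ m
half-digit zero    m = half-2* m
half-digit (suc _) m rewrite lowBit-2* m = half-2* m

shift-0 : ∀ n → shift 0 n ≡ 0
shift-0 zero    = refl
shift-0 (suc n) = cong half (shift-0 n)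

bit-binary-low : ∀ b n j → bit (binary b (suc n)) (suc j) ≡ bit (binary (b ∘ suc) n) j
bit-binary-low b n j = cong lowBit (begin
  shift (binary b (suc n)) (suc j)
    ≡⟨ sym (shift-half _ j) ⟩
  shift (half (binary b (suc n))) j
    ≡⟨ cong (λ z → shift (half z) j) (binary-low b n) ⟩
  shift (half (ifz (b 0) 0 1 + 2 * binary (b ∘ suc) n)) j
    ≡⟨ cong (λ z → shift z j) (half-digit (b 0) (binary (b ∘ suc) n)) ⟩
  shift (binary (b ∘ suc) n) j ∎)
  where open ≡-Reasoning

bit-binary-< : ∀ b n j → j < n → bit (binary b n) j ≡ ifz (b j) 0 1
bit-binary-< b (suc n) zero    _         =
  trans (cong lowBit (binary-low b n)) (lowBit-digit (b 0) (binary (b ∘ suc) n))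
bit-binary-< b (suc n) (suc j) (s≤s j<n) =
  trans (bit-binary-low b n j) (bit-binary-< (b ∘ suc) n j j<n)

bit-binary-≥ : ∀ b n j → n ≤ j → bit (binary b n) j ≡ 0
bit-binary-≥ b zero    j       _         = cong lowBit (shift-0 j)
bit-binary-≥ b (suc n) (suc j) (s≤s n≤j) =
  trans (bit-binary-low b n j) (bit-binary-≥ (b ∘ suc) n j n≤j)

binary-cong : ∀ {b b′} n → (∀ j → j < n → b j ≡ b′ j) → binary b n ≡ binary b′ n
binary-cong zero    eq = refl
binary-cong (suc n) eq = cong₂ _+_ (cong (λ k → ifz k 0 (2 ^ n)) (eq n ≤-refl))
                                   (binary-cong n (λ j j<n → eq j (m<n⇒m<1+n j<n)))

binary-extend : ∀ {b m} n → m ≤′ n → (∀ j → m ≤ j → b j ≡ 0) → binary b n ≡ binary b m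
binary-extend n ≤′-refl       z = refl
binary-extend (suc n) (≤′-step m≤n) z rewrite z n (≤′⇒≤ m≤n) = binary-extend n m≤n z

lowBit≤1 : ∀ n → lowBit n ≤ 1
lowBit≤1 zero    = z≤n
lowBit≤1 (suc n) = m∸n≤m 1 (lowBit n)

half≤pred : ∀ n → half n ≤ pred n
half≤pred zero          = z≤n
half≤pred (suc zero)    = z≤n
half≤pred (suc (suc n)) = +-mono-≤ (lowBit≤1 (suc n)) (half≤pred (suc n))

-- Halving lowers every positive number. Consequently d has only zero digits from place d on, and
-- the code of a finite set bounds its elements.
shift≤∸ : ∀ d n → shift d n ≤ d ∸ n
shift≤∸ d zero    = ≤-refl
shift≤∸ d (suc n) = ≤-trans (half≤pred (shift d n))
  (≤-trans (pred-mono-≤ (shift≤∸ d n)) (≤-reflexive (pred[m∸n]≡m∸[1+n] d n)))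

bit-≥ : ∀ d j → d ≤ j → bit d j ≡ 0
bit-≥ d j d≤j with shift d j | ≤-trans (shift≤∸ d j) (≤-reflexive (m≤n⇒m∸n≡0 d≤j))
... | .0 | z≤n = refl

-- A universal program

-- A machine state ⟪ v , K ⟫ is a current value with a stack of instructions
-- (0 is the empty stack).  The instructions tagged 0–8 are the codes of
-- programs, to be applied to v; those tagged 9–12 resume a half-executed
-- pairC (9, 10), recC (11) or muC (12).
push : ℕ → ℕ → ℕ
push i K = suc ⟪ i , K ⟫

Instruction : Set
Instruction = ℕ → ℕ → ℕ → ℕ

instructions : List Instruction
instructions =
    (λ v a K → ⟪ 0 , K ⟫)
  ∷ (λ v a K → ⟪ suc v , K ⟫)
  ∷ (λ v a K → ⟪ v , K ⟫)
  ∷ (λ v a K → ⟪ π₁ v , K ⟫)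
  ∷ (λ v a K → ⟪ π₂ v , K ⟫)
  ∷ (λ v a K → ⟪ v , push (π₂ a) (push (π₁ a) K) ⟫)
  ∷ (λ v a K → ⟪ v , push (π₁ a) (push ⟪ 9 , ⟪ v , π₂ a ⟫ ⟫ K) ⟫)
  ∷ (λ v a K → ifz (π₂ v)
        ⟪ π₁ v , push (π₁ a) K ⟫
        ⟪ ⟪ π₁ v , pred (π₂ v) ⟫
        , push ⟪ 7 , a ⟫ (push ⟪ 11 , ⟪ ⟪ π₁ v , pred (π₂ v) ⟫ , π₂ a ⟫ ⟫ K) ⟫)
  ∷ (λ v a K → ⟪ ⟪ v , 0 ⟫ , push a (push ⟪ 12 , ⟪ ⟪ v , 0 ⟫ , a ⟫ ⟫ K) ⟫)
  ∷ (λ v a K → ⟪ π₁ a , push (π₂ a) (push ⟪ 10 , v ⟫ K) ⟫)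
  ∷ (λ v a K → ⟪ ⟪ a , v ⟫ , K ⟫)
  ∷ (λ v a K → ⟪ ⟪ π₁ (π₁ a) , ⟪ π₂ (π₁ a) , v ⟫ ⟫ , push (π₂ a) K ⟫)
  ∷ (λ v a K → ifz v
        ⟪ π₂ (π₁ a) , K ⟫
        ⟪ ⟪ π₁ (π₁ a) , suc (π₂ (π₁ a)) ⟫
        , push (π₂ a) (push ⟪ 12 , ⟪ ⟪ π₁ (π₁ a) , suc (π₂ (π₁ a)) ⟫ , π₂ a ⟫ ⟫ K) ⟫)
  ∷ []

dispatch : List Instruction → ℕ → Instruction
dispatch []       t       v a K = v
dispatch (i ∷ is) zero    v a K = i v a K
dispatch (i ∷ is) (suc t) v a K = dispatch is t v a K

top rest : ℕ → ℕ
top  s = π₁ (pred (π₂ s))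
rest s = π₂ (pred (π₂ s))

-- A state with empty stack is a fixed point, so a halted computation keeps its result at all later
-- times.
step : ℕ → ℕ
step s = ifz (π₂ s) s (dispatch instructions (π₁ (top s)) (π₁ s) (π₂ (top s)) (rest s))

dispatchᶜ : ∀ {is t v a K} → All (Computable ∘ uncurry₃) is →
            Computable t → Computable v → Computable a → Computable K →
            Computable (λ x → dispatch is (t x) (v x) (a x) (K x))
dispatchᶜ [] T V A S = V
dispatchᶜ {i ∷ is} {t} {v} {a} {K} (I ∷ Is) T V A S =
  comp-cong (λ x → eq (t x) (v x) (a x) (K x))
    (ifzᶜ T (I ∘ᶜ ⟪ V , ⟪ A , S ⟫ᶜ ⟫ᶜ) (dispatchᶜ Is (predᶜ T) V A S))
  where
  eq : ∀ t v a K → ifz t (uncurry₃ i ⟪ v , ⟪ a , K ⟫ ⟫) (dispatch is (pred t) v a K)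
                 ≡ dispatch (i ∷ is) t v a K
  eq zero    v a K = uncurry₃-⟪⟫ i v a K
  eq (suc t) v a K = refl

instructionsᶜ : All (Computable ∘ uncurry₃) instructions
instructionsᶜ =
    ⟪ constᶜ 0 , K ⟫ᶜ
  ∷ ⟪ sucᶜ v , K ⟫ᶜ
  ∷ ⟪ v , K ⟫ᶜ
  ∷ ⟪ fstᶜ v , K ⟫ᶜ
  ∷ ⟪ sndᶜ v , K ⟫ᶜ
  ∷ ⟪ v , pushᶜ (sndᶜ a) (pushᶜ (fstᶜ a) K) ⟫ᶜ
  ∷ ⟪ v , pushᶜ (fstᶜ a) (pushᶜ ⟪ constᶜ 9 , ⟪ v , sndᶜ a ⟫ᶜ ⟫ᶜ K) ⟫ᶜ
  ∷ ifzᶜ (sndᶜ v)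
      ⟪ fstᶜ v , pushᶜ (fstᶜ a) K ⟫ᶜ
      ⟪ previous , pushᶜ ⟪ constᶜ 7 , a ⟫ᶜ (pushᶜ ⟪ constᶜ 11 , ⟪ previous , sndᶜ a ⟫ᶜ ⟫ᶜ K) ⟫ᶜ
  ∷ ⟪ ⟪ v , constᶜ 0 ⟫ᶜ , pushᶜ a (pushᶜ ⟪ constᶜ 12 , ⟪ ⟪ v , constᶜ 0 ⟫ᶜ , a ⟫ᶜ ⟫ᶜ K) ⟫ᶜ
  ∷ ⟪ fstᶜ a , pushᶜ (sndᶜ a) (pushᶜ ⟪ constᶜ 10 , v ⟫ᶜ K) ⟫ᶜ
  ∷ ⟪ ⟪ a , v ⟫ᶜ , K ⟫ᶜ
  ∷ ⟪ ⟪ fstᶜ (fstᶜ a) , ⟪ sndᶜ (fstᶜ a) , v ⟫ᶜ ⟫ᶜ , pushᶜ (sndᶜ a) K ⟫ᶜ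
  ∷ ifzᶜ v
      ⟪ sndᶜ (fstᶜ a) , K ⟫ᶜ
      ⟪ following , pushᶜ (sndᶜ a) (pushᶜ ⟪ constᶜ 12 , ⟪ following , sndᶜ a ⟫ᶜ ⟫ᶜ K) ⟫ᶜ
  ∷ []
  where
  v = fstᶜ idᶜ
  a = fstᶜ (sndᶜ idᶜ)
  K = sndᶜ (sndᶜ idᶜ)
  previous  = ⟪ fstᶜ v , predᶜ (sndᶜ v) ⟫ᶜ
  following = ⟪ fstᶜ (fstᶜ a) , sucᶜ (sndᶜ (fstᶜ a)) ⟫ᶜ
  pushᶜ : ∀ {f g} → Computable f → Computable g → Computable (λ x → push (f x) (g x))
  pushᶜ F G = sucᶜ ⟪ F , G ⟫ᶜ

opaque
  stepᶜ : Computable step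
  stepᶜ = ifzᶜ (sndᶜ idᶜ) idᶜ
    (dispatchᶜ instructionsᶜ (fstᶜ topᶜ) (fstᶜ idᶜ) (sndᶜ topᶜ) (sndᶜ framesᶜ))
    where
    framesᶜ : Computable (λ s → pred (π₂ s))
    framesᶜ = predᶜ (sndᶜ idᶜ)
    topᶜ : Computable top
    topᶜ = fstᶜ framesᶜ

step-push : ∀ v t a K →
            step ⟪ v , push ⟪ t , a ⟫ K ⟫ ≡ dispatch instructions t v a K
step-push v t a K
  rewrite π₂-⟪⟫ v (push ⟪ t , a ⟫ K) | π₁-⟪⟫ v (push ⟪ t , a ⟫ K)
        | π₁-⟪⟫ ⟪ t , a ⟫ K | π₂-⟪⟫ ⟪ t , a ⟫ K | π₁-⟪⟫ t a | π₂-⟪⟫ t a = refl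

infix 4 _⟶*_
data _⟶*_ : ℕ → ℕ → Set where
  done : ∀ {s} → s ⟶* s
  _then_ : ∀ {s t u} → step s ≡ t → t ⟶* u → s ⟶* u

infixr 5 _then_ _⊕_
_⊕_ : ∀ {s t u} → s ⟶* t → t ⟶* u → s ⟶* u
done       ⊕ r = r
(e then q) ⊕ r = e then (q ⊕ r)

exec : ∀ {v t a K s u} → dispatch instructions t v a K ≡ s → s ⟶* u →
       ⟪ v , push ⟪ t , a ⟫ K ⟫ ⟶* u
exec eq r = trans (step-push _ _ _ _) eq then r

comp-step : ∀ v f g K → dispatch instructions 5 v ⟪ f , g ⟫ K ≡ ⟪ v , push g (push f K) ⟫
comp-step v f g K rewrite π₁-⟪⟫ f g | π₂-⟪⟫ f g = refl

pair-step : ∀ v f g K → dispatch instructions 6 v ⟪ f , g ⟫ K ≡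
            ⟪ v , push f (push ⟪ 9 , ⟪ v , g ⟫ ⟫ K) ⟫
pair-step v f g K rewrite π₁-⟪⟫ f g | π₂-⟪⟫ f g = refl

rec0-step : ∀ x f g K → dispatch instructions 7 ⟪ x , 0 ⟫ ⟪ f , g ⟫ K ≡ ⟪ x , push f K ⟫
rec0-step x f g K rewrite π₂-⟪⟫ x 0 | π₁-⟪⟫ x 0 | π₁-⟪⟫ f g = refl

recS-step : ∀ x n f g K → dispatch instructions 7 ⟪ x , suc n ⟫ ⟪ f , g ⟫ K ≡
            ⟪ ⟪ x , n ⟫ , push ⟪ 7 , ⟪ f , g ⟫ ⟫ (push ⟪ 11 , ⟪ ⟪ x , n ⟫ , g ⟫ ⟫ K) ⟫
recS-step x n f g K rewrite π₂-⟪⟫ x (suc n) | π₁-⟪⟫ x (suc n) | π₂-⟪⟫ f g = refl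

pair₁-step : ∀ u v g K → dispatch instructions 9 u ⟪ v , g ⟫ K ≡ ⟪ v , push g (push ⟪ 10 , u ⟫ K) ⟫
pair₁-step u v g K rewrite π₁-⟪⟫ v g | π₂-⟪⟫ v g = refl

rec-resume : ∀ u x n g K → dispatch instructions 11 u ⟪ ⟪ x , n ⟫ , g ⟫ K ≡
             ⟪ ⟪ x , ⟪ n , u ⟫ ⟫ , push g K ⟫
rec-resume u x n g K
  rewrite π₁-⟪⟫ ⟪ x , n ⟫ g | π₂-⟪⟫ ⟪ x , n ⟫ g | π₁-⟪⟫ x n | π₂-⟪⟫ x n = refl

mu-found : ∀ x n f K → dispatch instructions 12 0 ⟪ ⟪ x , n ⟫ , f ⟫ K ≡ ⟪ n , K ⟫
mu-found x n f K rewrite π₁-⟪⟫ ⟪ x , n ⟫ f | π₂-⟪⟫ x n = refl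

mu-next : ∀ k x n f K → dispatch instructions 12 (suc k) ⟪ ⟪ x , n ⟫ , f ⟫ K ≡
          ⟪ ⟪ x , suc n ⟫ , push f (push ⟪ 12 , ⟪ ⟪ x , suc n ⟫ , f ⟫ ⟫ K) ⟫
mu-next k x n f K
  rewrite π₁-⟪⟫ ⟪ x , n ⟫ f | π₂-⟪⟫ ⟪ x , n ⟫ f | π₁-⟪⟫ x n | π₂-⟪⟫ x n = refl

-- The value of `encode` in terms of the opaque pairing, and at the same time the machine
-- instruction that runs the program.
⌜_⌝ : Code → ℕ
⌜ zeroC ⌝     = ⟪ 0 , 0 ⟫
⌜ succC ⌝     = ⟪ 1 , 0 ⟫
⌜ idC ⌝       = ⟪ 2 , 0 ⟫
⌜ fstC ⌝      = ⟪ 3 , 0 ⟫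
⌜ sndC ⌝      = ⟪ 4 , 0 ⟫
⌜ compC f g ⌝ = ⟪ 5 , ⟪ ⌜ f ⌝ , ⌜ g ⌝ ⟫ ⟫
⌜ pairC f g ⌝ = ⟪ 6 , ⟪ ⌜ f ⌝ , ⌜ g ⌝ ⟫ ⟫
⌜ recC f g ⌝  = ⟪ 7 , ⟪ ⌜ f ⌝ , ⌜ g ⌝ ⟫ ⟫
⌜ muC f ⌝     = ⟪ 8 , ⌜ f ⌝ ⟫

pair₂≡⟪⟫ : ∀ t {a b a′ b′} → a ≡ a′ → b ≡ b′ → pair t (pair a b) ≡ ⟪ t , ⟪ a′ , b′ ⟫ ⟫
pair₂≡⟪⟫ t {a} {b} refl refl = trans (cong (pair t) (pair≡⟪⟫ a b)) (pair≡⟪⟫ t ⟪ a , b ⟫)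

encode≡⌜⌝ : ∀ c → encode c ≡ ⌜ c ⌝
encode≡⌜⌝ zeroC       = pair≡⟪⟫ 0 0
encode≡⌜⌝ succC       = pair≡⟪⟫ 1 0
encode≡⌜⌝ idC         = pair≡⟪⟫ 2 0
encode≡⌜⌝ fstC        = pair≡⟪⟫ 3 0
encode≡⌜⌝ sndC        = pair≡⟪⟫ 4 0
encode≡⌜⌝ (compC f g) = pair₂≡⟪⟫ 5 (encode≡⌜⌝ f) (encode≡⌜⌝ g)
encode≡⌜⌝ (pairC f g) = pair₂≡⟪⟫ 6 (encode≡⌜⌝ f) (encode≡⌜⌝ g)
encode≡⌜⌝ (recC f g)  = pair₂≡⟪⟫ 7 (encode≡⌜⌝ f) (encode≡⌜⌝ g)
encode≡⌜⌝ (muC f)     = trans (cong (pair 8) (encode≡⌜⌝ f)) (pair≡⟪⟫ 8 ⌜ f ⌝)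

mutual
  -- Induction on the evaluation. The stack below is arbitrary, because a subprogram runs above the
  -- frame that resumes its caller.
  simulate : ∀ {c x v} → Eval c x v → ∀ K → ⟪ x , push ⌜ c ⌝ K ⟫ ⟶* ⟪ v , K ⟫
  simulate (ev-zero x)  K = exec refl done
  simulate (ev-succ x)  K = exec refl done
  simulate (ev-id x)    K = exec refl done
  simulate (ev-fst y z) K rewrite pair≡⟪⟫ y z =
    exec (cong (λ w → ⟪ w , K ⟫) (π₁-⟪⟫ y z)) done
  simulate (ev-snd y z) K rewrite pair≡⟪⟫ y z =
    exec (cong (λ w → ⟪ w , K ⟫) (π₂-⟪⟫ y z)) done
  simulate (ev-comp d e) K =
    exec (comp-step _ _ _ _) (simulate d _ ⊕ simulate e K)
  simulate (ev-pair {u = u} {v} d e) K rewrite pair≡⟪⟫ u v =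
    exec (pair-step _ _ _ _) (simulate d _ ⊕
    exec (pair₁-step _ _ _ _) (simulate e _ ⊕
    exec refl done))
  simulate (ev-rec0 {x = x} d) K rewrite pair≡⟪⟫ x 0 =
    exec (rec0-step _ _ _ _) (simulate d K)
  simulate (ev-recS {x = x} {n = n} {u = u} d e) K
    -- Taken first, so that the rewrites replace `pair` in the types of both runs.
    with simulate d | simulate e K
  ... | r | r′ rewrite pair≡⟪⟫ n u | pair≡⟪⟫ x ⟪ n , u ⟫ | pair≡⟪⟫ x n | pair≡⟪⟫ x (suc n) =
    exec (recS-step _ _ _ _ _) (r _ ⊕ exec (rec-resume _ _ _ _ _) r′)
  simulate (ev-mu {n = n} d f) K =
    exec refl (search d f K 0 n refl)

  simulate-⟪⟫ : ∀ {c v} x m → Eval c (pair x m) v → ∀ K →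
                ⟪ ⟪ x , m ⟫ , push ⌜ c ⌝ K ⟫ ⟶* ⟪ v , K ⟫
  simulate-⟪⟫ {c} {v} x m d K =
    subst (λ z → ⟪ z , push ⌜ c ⌝ K ⟫ ⟶* ⟪ v , K ⟫) (pair≡⟪⟫ x m) (simulate d K)

  -- The loop of `muC` entered at candidate `m`; the recursion is on the number `j` of failing
  -- candidates still ahead.
  search : ∀ {c x n} → Eval c (pair x n) 0 →
           (∀ m → m < n → ∃ λ k → Eval c (pair x m) (suc k)) →
           ∀ K m j → m + j ≡ n →
           ⟪ ⟪ x , m ⟫ , push ⌜ c ⌝ (push ⟪ 12 , ⟪ ⟪ x , m ⟫ , ⌜ c ⌝ ⟫ ⟫ K) ⟫ ⟶* ⟪ n , K ⟫
  search {c} {x} d f K m zero eq with refl ← trans (sym (+-identityʳ m)) eq =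
    simulate-⟪⟫ x m d _ ⊕ exec (mu-found x m ⌜ c ⌝ K) done
  search {c} {x} d f K m (suc j) eq =
    let m<n = subst (m <_) eq (m<m+n m (s≤s z≤n)) in
    simulate-⟪⟫ x m (proj₂ (f m m<n)) _ ⊕
    exec (mu-next (proj₁ (f m m<n)) x m ⌜ c ⌝ K)
      (search d f K (suc m) j (trans (sym (+-suc m j)) eq))

iterate : ℕ → ℕ → ℕ
iterate s = natrec s (λ _ → step)

⟶*⇒iterate : ∀ {s t} → s ⟶* t → ∃ λ n → iterate s n ≡ t
⟶*⇒iterate done = 0 , refl
⟶*⇒iterate {s} (_then_ {t = t} e r) with ⟶*⇒iterate r
... | n , eq = suc n , trans (iterate-suc n) eq
  where
  iterate-suc : ∀ n → iterate s (suc n) ≡ iterate t n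
  iterate-suc zero    = e
  iterate-suc (suc n) = cong step (iterate-suc n)

-- Turns some halting time into the first one, with the evidence about earlier times that `ev-mu`
-- demands.
least-zero : (f : ℕ → ℕ) → ∀ n → f n ≡ 0 →
             ∃ λ m → m ≤ n × f m ≡ 0 × (∀ j → j < m → ∃ λ k → f j ≡ suc k)
least-zero f zero    fn≡0 = 0 , z≤n , fn≡0 , λ _ ()
least-zero f (suc n) fn≡0 with f 0 in f0
... | zero  = 0 , z≤n , f0 , λ _ ()
... | suc k with least-zero (f ∘ suc) n fn≡0
...   | m , m≤n , fm≡0 , below = suc m , s≤s m≤n , fm≡0 ,
        λ { zero _ → k , f0 ; (suc j) (s≤s j<m) → below j j<m }

haltingᶜ : Computable (λ z → π₂ (iterate (π₁ z) (π₂ z)))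
haltingᶜ = sndᶜ (recᶜ {g = λ _ _ → step} (fstᶜ idᶜ) (stepᶜ ∘ᶜ sndᶜ (sndᶜ idᶜ)) (sndᶜ idᶜ))

resultᶜ : Computable (λ z → π₁ (iterate (π₁ z) (π₂ z)))
resultᶜ = fstᶜ (recᶜ {g = λ _ _ → step} (fstᶜ idᶜ) (stepᶜ ∘ᶜ sndᶜ (sndᶜ idᶜ)) (sndᶜ idᶜ))

initialᶜ : Computable (λ z → ⟪ π₂ z , push (π₁ z) 0 ⟫)
initialᶜ = ⟪ sndᶜ idᶜ , sucᶜ ⟪ fstᶜ idᶜ , constᶜ 0 ⟫ᶜ ⟫ᶜ

iterate-halted : ∀ {s v m} n → m ≤′ n → π₂ (iterate s m) ≡ 0 → iterate s n ≡ ⟪ v , 0 ⟫ →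
                 π₁ (iterate s m) ≡ v
iterate-halted n ≤′-refl _ eq = trans (cong π₁ eq) (π₁-⟪⟫ _ 0)
iterate-halted {s} {v} {m} (suc n) (≤′-step m≤n) halted eq =
  iterate-halted n m≤n halted (trans (sym (stays n m≤n)) eq)
  where
  stays : ∀ n → m ≤′ n → step (iterate s n) ≡ iterate s n
  stays n ≤′-refl = stay-put (iterate s n) halted
    where
    stay-put : ∀ t → π₂ t ≡ 0 → step t ≡ t
    stay-put t eq rewrite eq = refl
  stays (suc n) (≤′-step m≤n) = cong step (stays n m≤n)

opaque
  -- Minimisation looks for the first time at which the stack is empty; the value held then is the
  -- result.
  universal : Code
  universal = compC (compC (proj₁ resultᶜ) (pairC idC (muC (proj₁ haltingᶜ)))) (proj₁ initialᶜ)

  ev-halting : ∀ s n {v} → π₂ (iterate s n) ≡ v → Eval (proj₁ haltingᶜ) (pair s n) v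
  ev-halting s n eq = subst₂ (Eval (proj₁ haltingᶜ)) (sym (pair≡⟪⟫ s n))
    (trans (cong₂ (λ s n → π₂ (iterate s n)) (π₁-⟪⟫ s n) (π₂-⟪⟫ s n)) eq)
    (proj₂ haltingᶜ ⟪ s , n ⟫)

  ev-result : ∀ s n {v} → π₁ (iterate s n) ≡ v → Eval (proj₁ resultᶜ) ⟪ s , n ⟫ v
  ev-result s n eq = subst (Eval (proj₁ resultᶜ) ⟪ s , n ⟫)
    (trans (cong₂ (λ s n → π₁ (iterate s n)) (π₁-⟪⟫ s n) (π₂-⟪⟫ s n)) eq)
    (proj₂ resultᶜ ⟪ s , n ⟫)

  ev-initial : ∀ e x → Eval (proj₁ initialᶜ) ⟪ e , x ⟫ ⟪ x , push e 0 ⟫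
  ev-initial e x = subst (Eval (proj₁ initialᶜ) ⟪ e , x ⟫)
    (cong₂ (λ x e → ⟪ x , push e 0 ⟫) (π₂-⟪⟫ e x) (π₁-⟪⟫ e x))
    (proj₂ initialᶜ ⟪ e , x ⟫)

  ev-iterate : ∀ {e x v} n → iterate ⟪ x , push e 0 ⟫ n ≡ ⟪ v , 0 ⟫ → Eval universal ⟪ e , x ⟫ v
  ev-iterate {e} {x} {v} n eq
    with least-zero (λ n → π₂ (iterate ⟪ x , push e 0 ⟫ n)) n (trans (cong π₂ eq) (π₂-⟪⟫ v 0))
  ... | m , m≤n , halted , below =
    ev-comp (ev-initial e x) (ev-comp
      (ev-⟪⟫ (ev-id _) (ev-mu (ev-halting _ m halted)
        (λ j j<m → proj₁ (below j j<m) , ev-halting _ j (proj₂ (below j j<m)))))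
      (ev-result _ m (iterate-halted n (≤⇒≤′ m≤n) halted eq)))

-- By `encode≡⌜⌝` the index is itself the instruction to push, so the machine needs no decoding
-- phase.
ev-universal : ∀ {e x v} → φ e x v → Eval universal ⟪ e , x ⟫ v
ev-universal {x = x} {v} (c , refl , d) with ⟶*⇒iterate (simulate d 0)
... | n , eq = subst (λ e → Eval universal ⟪ e , x ⟫ v) (sym (encode≡⌜⌝ c)) (ev-iterate n eq)

-- Canonical codes of finite sets

χ : List ℕ → ℕ → ℕ
χ l n = if does (n ∈? l) then 1 else 0

setCodeBelow≡binary : ∀ l n → setCodeBelow l n ≡ binary (χ l) n
setCodeBelow≡binary l zero = refl
setCodeBelow≡binary l (suc n) with n ∈? l
... | yes _ = cong (2 ^ n +_) (setCodeBelow≡binary l n)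
... | no  _ = setCodeBelow≡binary l n

∈⇒<bound : ∀ {l x} → x ∈ l → x < bound l
∈⇒<bound {y ∷ l} (here refl) = m≤m⊔n (suc y) (bound l)
∈⇒<bound {y ∷ l} (there x∈l) = ≤-trans (∈⇒<bound x∈l) (m≤n⊔m (suc y) (bound l))

-- Places below `bound l` carry the characteristic function; from there on both the digits and the
-- list are empty.
bit-setCode : ∀ l x → (x ∈ l × bit (setCode l) x ≡ 1) ⊎ (¬ x ∈ l × bit (setCode l) x ≡ 0)
bit-setCode l x rewrite setCodeBelow≡binary l (bound l) with x <? bound l
... | no  x≮bound = inj₂ (x≮bound ∘ ∈⇒<bound , bit-binary-≥ (χ l) _ x (≮⇒≥ x≮bound))
... | yes x<bound rewrite bit-binary-< (χ l) (bound l) x x<bound with x ∈? l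
...   | yes x∈l = inj₁ (x∈l , refl)
...   | no  x∉l = inj₂ (x∉l , refl)

-- Texts

seen : Text → ℕ → List ℕ
seen T i = catMaybes (prefix T i)

seen-suc : ∀ T i → seen T (suc i) ≡ seen T i ++ catMaybes (T i ∷ [])
seen-suc T i = trans (cong catMaybes (sym (++-is-foldr (prefix T i) (T i ∷ []))))
                     (catMaybes-++ (prefix T i) (T i ∷ []))

∈-seen⁺ : ∀ {T i j x} → j <′ i → T j ≡ just x → x ∈ seen T i
∈-seen⁺ {T} {suc j} <′-base eq rewrite seen-suc T j | eq = ∈-++⁺ʳ (seen T j) (here refl)
∈-seen⁺ {T} {suc i} (≤′-step j<i) eq rewrite seen-suc T i = ∈-++⁺ˡ (∈-seen⁺ j<i eq)

∈-seen⁻ : ∀ {T} i {x} → x ∈ seen T i → content T x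
∈-seen⁻ {T} (suc i) x∈ rewrite seen-suc T i with ∈-++⁻ (seen T i) x∈
... | inj₁ x∈seen = ∈-seen⁻ i x∈seen
... | inj₂ x∈last with T i in eq | x∈last
...   | just _ | here refl = i , eq

-- With a pause after each entry, a hypothesis s that survives a place satisfies h(s, #) = s. It
-- then also survives places whose element is replaced by a pause.
padded : Text → Text
padded a zero          = a 0
padded a (suc zero)    = nothing
padded a (suc (suc n)) = padded (a ∘ suc) n

padded-even : ∀ a n → padded a (n * 2) ≡ a n
padded-even a zero    = refl
padded-even a (suc n) = padded-even (a ∘ suc) n

padded-odd : ∀ a n → padded a (suc (n * 2)) ≡ nothing
padded-odd a zero    = refl
padded-odd a (suc n) = padded-odd (a ∘ suc) n

content-padded : ∀ a → SameLang (content (padded a)) (content a)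
content-padded a x = (λ { (i , eq) → to a i eq }) ,
                     (λ { (i , eq) → i * 2 , trans (padded-even a i) eq })
  where
  to : ∀ a i → padded a i ≡ just x → content a x
  to a zero eq = 0 , eq
  to a (suc (suc i)) eq with j , eq′ ← to (a ∘ suc) i eq = suc j , eq′

-- Continues a finite reading to a full text, which makes assumptions about whole texts available
-- for finite runs.
splice : ℕ → Text → Text → Text
splice zero    a T n       = T n
splice (suc N) a T zero    = a 0
splice (suc N) a T (suc n) = splice N (a ∘ suc) T n

splice-< : ∀ {N} a T j → j < N → splice N a T j ≡ a j
splice-< a T zero    (s≤s _)   = refl
splice-< a T (suc j) (s≤s j<N) = splice-< (a ∘ suc) T j j<N

content-splice : ∀ N {a T} → (∀ {x} → content a x → content T x) →
                 SameLang (content (splice N a T)) (content T)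
content-splice zero sub x = (λ p → p) , (λ p → p)
content-splice (suc N) {a} {T} sub x = to , from
  where
  tail = content-splice N {a ∘ suc} {T} (λ { (i , eq) → sub (suc i , eq) }) x
  to : content (splice (suc N) a T) x → content T x
  to (zero  , eq) = sub (0 , eq)
  to (suc i , eq) = proj₁ tail (i , eq)
  from : content T x → content (splice (suc N) a T) x
  from p with i , eq ← proj₂ tail p = suc i , eq

SameLang-trans : ∀ {L M N} → SameLang L M → SameLang M N → SameLang L N
SameLang-trans p q x = proj₁ (q x) ∘ proj₁ (p x) , proj₂ (p x) ∘ proj₂ (q x)

SameLang-sym : ∀ {L M} → SameLang L M → SameLang M L
SameLang-sym p x = proj₂ (p x) , proj₁ (p x)

-- Characteristic functions

Decides : (ℕ → ℕ) → Lang → Set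
Decides ℓ L = ∀ x → (ℓ x ≡ 1 × L x) ⊎ (ℓ x ≡ 0 × ¬ L x)

recursive⇒decides : ∀ {L} → Recursive L → ∃[ ℓ ] Decides ℓ L
recursive⇒decides {L} (e , total , same) = (λ x → proj₁ (total x)) , decide
  where
  decide : Decides (λ x → proj₁ (total x)) L
  decide x with total x
  ... | zero        , φ≡0 , _ = inj₂ (refl , λ Lx → contradiction (φ-det φ≡0 (proj₂ (same x) Lx)) λ ())
  ... | suc zero    , φ≡1 , _ = inj₁ (refl , proj₁ (same x) φ≡1)
  ... | suc (suc _) , _   , s≤s ()

φ-decides : ∀ {e ℓ L} → CIndex e → SameLang (C e) L → Decides ℓ L → ∀ x → φ e x (ℓ x)
φ-decides total same decides x with decides x
... | inj₁ (ℓ≡1 , Lx) rewrite ℓ≡1 = proj₂ (same x) Lx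
... | inj₂ (ℓ≡0 , ¬Lx) rewrite ℓ≡0 with total x
...   | zero        , φ≡0 , _ = φ≡0
...   | suc zero    , φ≡1 , _ = contradiction (proj₁ (same x) φ≡1) ¬Lx
...   | suc (suc _) , _   , s≤s ()

decides-φ : ∀ {e ℓ L} → Decides ℓ L → (∀ x → φ e x (ℓ x)) → CIndex e × SameLang (C e) L
decides-φ {e} {ℓ} {L} decides value = total , same
  where
  total : CIndex e
  total x with value x | decides x
  ... | d | inj₁ (ℓ≡1 , _) = ℓ x , d , ≤-reflexive ℓ≡1
  ... | d | inj₂ (ℓ≡0 , _) = ℓ x , d , ≤-trans (≤-reflexive ℓ≡0) z≤n
  same : SameLang (C e) L
  same x with value x | decides x
  ... | d | inj₁ (ℓ≡1 , Lx)  = (λ _ → Lx) , (λ _ → subst (φ e x) ℓ≡1 d)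
  ... | d | inj₂ (ℓ≡0 , ¬Lx) = (λ d′ → contradiction (trans (sym ℓ≡0) (φ-det d d′)) λ ()) ,
                               (λ Lx → contradiction Lx ¬Lx)

-- Induction on `n`: the decision procedure says whether `n` occurs in the text, and if so the
-- content provides a position to wait for.
eventually-seen : ∀ {T ℓ} → Decides ℓ (content T) → ∀ n → ∃[ i₀ ] ∀ i → i₀ ≤ i →
                  ∀ j → j < n → content T j → j ∈ seen T i
eventually-seen decides zero = 0 , λ _ _ _ ()
eventually-seen {T} decides (suc n) with eventually-seen decides n | decides n
... | i₀ , now | inj₂ (_ , n∉T) = i₀ , later
  where
  later : ∀ i → i₀ ≤ i → ∀ j → j < suc n → content T j → j ∈ seen T i
  later i i₀≤i j (s≤s j≤n) j∈T with m≤n⇒m<n∨m≡n j≤n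
  ... | inj₁ j<n  = now i i₀≤i j j<n j∈T
  ... | inj₂ refl = contradiction j∈T n∉T
... | i₀ , now | inj₁ (_ , k , eq) = i₀ ⊔ suc k , later
  where
  later : ∀ i → i₀ ⊔ suc k ≤ i → ∀ j → j < suc n → content T j → j ∈ seen T i
  later i ≤i j (s≤s j≤n) j∈T with m≤n⇒m<n∨m≡n j≤n
  ... | inj₁ j<n  = now i (≤-trans (m≤m⊔n i₀ (suc k)) ≤i) j j<n j∈T
  ... | inj₂ refl = ∈-seen⁺ (≤⇒≤′ (≤-trans (m≤n⊔m i₀ (suc k)) ≤i)) eq

cell : ℕ → ℕ → Maybe ℕ
cell n k = ifz k nothing (just n)

-- Element and place coincide: the set is read in increasing order, and restricting it to numbers
-- below c changes the text only from place c on.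
symbol : (ℕ → ℕ) → Text
symbol b n = cell n (b n)

symbol-just : ∀ {b n x} → symbol b n ≡ just x → n ≡ x × b n ≢ 0
symbol-just {b} {n} eq with b n
symbol-just refl | suc _ = refl , λ ()

dist : ℕ → ℕ → ℕ
dist m n = (m ∸ n) + (n ∸ m)

dist-refl : ∀ n → dist n n ≡ 0
dist-refl n rewrite n∸n≡0 n = refl

dist≡0⇒≡ : ∀ m n → dist m n ≡ 0 → m ≡ n
dist≡0⇒≡ m n eq = ≤-antisym (m∸n≡0⇒m≤n (m+n≡0⇒m≡0 (m ∸ n) eq))
                            (m∸n≡0⇒m≤n (m+n≡0⇒n≡0 (m ∸ n) eq))

-- Runs of an iterative learner over a set in increasing order

module Simulation (h : Code) where

  Next : ℕ → Maybe ℕ → ℕ → Set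
  Next s m u = Eval h (suc (pair s (codeSym m))) u

  -- Run a n s c: after reading a₀ # a₁ # … aₙ₋₁ # the hypothesis is s, and c ≤ n
  -- is least such that reading a_c # … aₙ₋₁ # has left it unchanged throughout.
  data Run (a : ℕ → Maybe ℕ) : ℕ → ℕ → ℕ → Set where
    start : ∀ {s} → Eval h 0 s → Run a 0 s 0
    stay  : ∀ {n s c} → Run a n s c → Next s (a n) s → Next s nothing s → Run a (suc n) s c
    move  : ∀ {n s c u v} → Run a n s c → Next s (a n) u → Next u nothing v →
            ¬ (s ≡ u × u ≡ v) → Run a (suc n) v (suc n)

  Run-det : ∀ {a n s c s′ c′} → Run a n s c → Run a n s′ c′ → s ≡ s′ × c ≡ c′
  Run-det (start d) (start d′) = Eval-det refl d d′ , refl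
  Run-det (stay r d e) (stay r′ d′ e′) = Run-det r r′
  Run-det (stay r d e) (move r′ d′ e′ ≢) with refl , refl ← Run-det r r′
    with refl ← Eval-det refl d d′ = contradiction (refl , Eval-det refl e e′) ≢
  Run-det (move r d e ≢) (stay r′ d′ e′) with refl , refl ← Run-det r r′
    with refl ← Eval-det refl d d′ = contradiction (refl , Eval-det refl e′ e) ≢
  Run-det (move r d e ≢) (move r′ d′ e′ ≢′) with refl , refl ← Run-det r r′
    with refl ← Eval-det refl d d′ = Eval-det refl e e′ , refl

  Run-≤ : ∀ {a n s c} → Run a n s c → c ≤ n
  Run-≤ (start d)      = z≤n
  Run-≤ (stay r d e)   = m≤n⇒m≤1+n (Run-≤ r)
  Run-≤ (move r d e _) = ≤-refl

  Run-cong : ∀ {a a′ n s c} → (∀ j → j < n → a j ≡ a′ j) → Run a n s c → Run a′ n s c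
  Run-cong eq (start d) = start d
  Run-cong eq (stay {n} {s} r d e) = stay (Run-cong (λ j j<n → eq j (m<n⇒m<1+n j<n)) r)
    (subst (λ m → Next s m s) (eq n ≤-refl) d) e
  Run-cong eq (move {n} {s} {u = u} r d e ≢) = move (Run-cong (λ j j<n → eq j (m<n⇒m<1+n j<n)) r)
    (subst (λ m → Next s m u) (eq n ≤-refl) d) e ≢

  Run-before : ∀ {a n s c} m → m ≤ n → Run a n s c → ∃[ s′ ] ∃[ c′ ] Run a m s′ c′
  Run-before m m≤n r with m≤n⇒m<n∨m≡n m≤n
  Run-before m m≤n r              | inj₂ refl      = _ , _ , r
  Run-before m m≤n (stay r d e)   | inj₁ (s≤s m≤n′) = Run-before m m≤n′ r
  Run-before m m≤n (move r d e _) | inj₁ (s≤s m≤n′) = Run-before m m≤n′ r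

  -- A `move` resets `c` to the current length. Hence all steps after a place m ≥ c are `stay`, and
  -- undoing them changes neither `s` nor `c`.
  Run-since : ∀ {a n s c} m → c ≤ m → m ≤ n → Run a n s c → Run a m s c
  Run-since m c≤m m≤n r with m≤n⇒m<n∨m≡n m≤n
  Run-since m c≤m m≤n r              | inj₂ refl       = r
  Run-since m c≤m m≤n (stay r d e)   | inj₁ (s≤s m≤n′) = Run-since m c≤m m≤n′ r
  Run-since m c≤m m≤n (move r d e _) | inj₁ m<n        = contradiction c≤m (<⇒≱ m<n)

  Run-pause : ∀ {a n s c} → Run a n s c → c < n → Next s nothing s
  Run-pause (stay r d e)   c<n = e
  Run-pause (move r d e _) n<n = contradiction n<n (<-irrefl refl)

  Run-extend : ∀ {a n s c} m → n ≤′ m → Run a n s c → Next s nothing s →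
               (∀ j → n ≤ j → Next s (a j) s) → Run a m s c
  Run-extend m       ≤′-refl       r d e = r
  Run-extend (suc m) (≤′-step n≤m) r d e = stay (Run-extend m n≤m r d e) (e m (≤′⇒≤ n≤m)) d

  Run-extend-pauses : ∀ {a n s c} m → n ≤ m → Run a n s c → Next s nothing s →
                      (∀ j → n ≤ j → a j ≡ nothing) → Run a m s c
  Run-extend-pauses {s = s} m n≤m r d pauses =
    Run-extend m (≤⇒≤′ n≤m) r d (λ j n≤j → subst (λ m → Next s m s) (sym (pauses j n≤j)) d)

  -- If c < m then h(s, #) = s, and as only pauses follow, the run has settled.
  Run-exhausted : ∀ {a e k} m → (∀ n → k ≤ n → Run a n e k) → (∀ j → m ≤ j → a j ≡ nothing) →
                  ∃[ s ] ∃[ c ] Run a m s c × ((k ≤ m × s ≡ e × c ≡ k) ⊎ (m < k × c ≡ m))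
  Run-exhausted {a} {e} {k} m settled pauses with k ≤? m
  ... | yes k≤m = e , k , settled m k≤m , inj₁ (k≤m , refl , refl)
  ... | no  k≰m with s , c , r ← Run-before m (<⇒≤ (≰⇒> k≰m)) (settled k ≤-refl)
    with m≤n⇒m<n∨m≡n (Run-≤ r)
  ...   | inj₂ c≡m = s , c , r , inj₂ (≰⇒> k≰m , c≡m)
  ...   | inj₁ c<m with refl , refl ← Run-det (settled k ≤-refl)
            (Run-extend-pauses k (<⇒≤ (≰⇒> k≰m)) r (Run-pause r c<m) pauses) =
    contradiction (<⇒≤ c<m) k≰m

  Run-suc : ∀ {a n s c u v} → Run a n s c → Next s (a n) u → Next u nothing v →
            ∃[ c′ ] Run a (suc n) v c′
  Run-suc {s = s} {u = u} {v} r d e with s ≟ u | u ≟ v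
  ... | yes refl | yes refl = _ , stay r d e
  ... | no s≢u   | _        = _ , move r d e (s≢u ∘ proj₁)
  ... | yes _    | no u≢v   = _ , move r d e (u≢v ∘ proj₂)

  Run-total : (∀ x → ∃ λ y → Eval h x y) → ∀ a n → ∃[ s ] ∃[ c ] Run a n s c
  Run-total total a zero    = _ , _ , start (proj₂ (total 0))
  Run-total total a (suc n) with s , c , r ← Run-total total a n =
    _ , Run-suc r (proj₂ (total _)) (proj₂ (total _))

  -- The set-driven learner

  ev-query : ∀ {q z s m u} → Eval q z (suc ⟪ s , codeSym m ⟫) → Next s m u → Eval (compC h q) z u
  ev-query {s = s} {m} d e =
    ev-comp (subst (λ w → Eval _ _ (suc w)) (sym (pair≡⟪⟫ s (codeSym m))) d) e

  read : ℕ → ℕ → ℕ → ℕ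
  read d n r = suc ⟪ π₁ r , ifz (bit d n) 0 (suc n) ⟫

  readᶜ : Computable (uncurry₃ read)
  readᶜ = sucᶜ ⟪ fstᶜ (sndᶜ (sndᶜ idᶜ)) , ifzᶜ (bitᶜ (fstᶜ idᶜ) n) (constᶜ 0) (sucᶜ n) ⟫ᶜ
    where n = fstᶜ (sndᶜ idᶜ)

  pauseᶜ : Computable (λ w → suc ⟪ π₂ w , 0 ⟫)
  pauseᶜ = sucᶜ ⟪ sndᶜ idᶜ , constᶜ 0 ⟫ᶜ

  -- r = ⟪ s , c ⟫ as in Run; u and v are the hypotheses after aₙ and aₙ #.
  update : ℕ → ℕ → ℕ → ℕ → ℕ
  update n r u v = ⟪ v , ifz (dist (π₁ r) u + dist u v) (π₂ r) (suc n) ⟫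

  updateᶜ : Computable (λ w → uncurry₃ (λ d n r → update n r (π₂ (π₁ w)) (π₂ w)) (π₁ (π₁ w)))
  updateᶜ = ⟪ v , ifzᶜ (+ᶜ (distᶜ (fstᶜ r) u) (distᶜ u v)) (sndᶜ r) (sucᶜ (fstᶜ (sndᶜ z))) ⟫ᶜ
    where
    z = fstᶜ (fstᶜ idᶜ)
    r = sndᶜ (sndᶜ z)
    u = sndᶜ (fstᶜ idᶜ)
    v = sndᶜ idᶜ
    distᶜ : ∀ {f g} → Computable f → Computable g → Computable (λ x → dist (f x) (g x))
    distᶜ F G = +ᶜ (∸ᶜ F G) (∸ᶜ G F)

  -- The input z of a recursion step grows to ⟪ z , u ⟫ and then to ⟪ ⟪ z , u ⟫ , v ⟫ by the two
  -- calls of `h`, and `update` reads all three.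
  body trajectory : Code
  body = compC (proj₁ updateᶜ) (compC (pairC idC (compC h (proj₁ pauseᶜ)))
                                      (pairC idC (compC h (proj₁ readᶜ))))
  trajectory = recC (pairC (compC h zeroC) zeroC) body

  ev-body : ∀ {d n s c u v} → Next s (symbol (bit d) n) u → Next u nothing v →
            Eval body ⟪ d , ⟪ n , ⟪ s , c ⟫ ⟫ ⟫ (update n ⟪ s , c ⟫ u v)
  ev-body {d} {n} {s} {c} {u} {v} p q = ev-comp
    (ev-comp
      (ev-⟪⟫ (ev-id z) (ev-query {m = symbol (bit d) n}
        (subst (Eval (proj₁ readᶜ) z) read≡ (proj₂ readᶜ z)) p))
      (ev-⟪⟫ (ev-id _) (ev-query {m = nothing}
        (subst (Eval (proj₁ pauseᶜ) ⟪ z , u ⟫) pause≡ (proj₂ pauseᶜ _)) q)))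
    (subst (Eval (proj₁ updateᶜ) w) update≡ (proj₂ updateᶜ w))
    where
    z w : ℕ
    z = ⟪ d , ⟪ n , ⟪ s , c ⟫ ⟫ ⟫
    w = ⟪ ⟪ z , u ⟫ , v ⟫
    code-symbol : ∀ k → ifz k 0 (suc n) ≡ codeSym (ifz k nothing (just n))
    code-symbol zero    = refl
    code-symbol (suc _) = refl
    read≡ : uncurry₃ read z ≡ suc ⟪ s , codeSym (symbol (bit d) n) ⟫
    read≡ = trans (uncurry₃-⟪⟫ read d n ⟪ s , c ⟫)
      (cong₂ (λ x y → suc ⟪ x , y ⟫) (π₁-⟪⟫ s c) (code-symbol (bit d n)))
    pause≡ : suc ⟪ π₂ ⟪ z , u ⟫ , 0 ⟫ ≡ suc ⟪ u , 0 ⟫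
    pause≡ = cong (λ x → suc ⟪ x , 0 ⟫) (π₂-⟪⟫ z u)
    update≡ : uncurry₃ (λ d n r → update n r (π₂ (π₁ w)) (π₂ w)) (π₁ (π₁ w)) ≡
              update n ⟪ s , c ⟫ u v
    update≡ rewrite π₁-⟪⟫ ⟪ z , u ⟫ v | π₂-⟪⟫ ⟪ z , u ⟫ v | π₁-⟪⟫ z u | π₂-⟪⟫ z u =
      uncurry₃-⟪⟫ (λ d n r → update n r u v) d n ⟪ s , c ⟫

  update-stay : ∀ n s c → update n ⟪ s , c ⟫ s s ≡ ⟪ s , c ⟫
  update-stay n s c rewrite π₁-⟪⟫ s c | dist-refl s | π₂-⟪⟫ s c = refl

  update-move : ∀ n s c u v → ¬ (s ≡ u × u ≡ v) → update n ⟪ s , c ⟫ u v ≡ ⟪ v , suc n ⟫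
  update-move n s c u v ≢ rewrite π₁-⟪⟫ s c with dist s u + dist u v in eq
  ... | suc _ = refl
  ... | zero  = contradiction
    (dist≡0⇒≡ s u (m+n≡0⇒m≡0 (dist s u) eq) , dist≡0⇒≡ u v (m+n≡0⇒n≡0 (dist s u) eq)) ≢

  ev-trajectory : ∀ {d n s c} → Run (symbol (bit d)) n s c → Eval trajectory ⟪ d , n ⟫ ⟪ s , c ⟫
  ev-trajectory (start p) = ev-rec-zero (ev-⟪⟫ (ev-comp (ev-zero _) p) (ev-zero _))
  ev-trajectory {d} (stay {n} {s} {c} r p q) = ev-rec-suc (ev-trajectory r)
    (subst (Eval body ⟪ d , ⟪ n , ⟪ s , c ⟫ ⟫ ⟫) (update-stay n s c) (ev-body p q))
  ev-trajectory {d} (move {n} {s} {c} {u} {v} r p q ≢) = ev-rec-suc (ev-trajectory r)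
    (subst (Eval body ⟪ d , ⟪ n , ⟪ s , c ⟫ ⟫ ⟫) (update-move n s c u v ≢) (ev-body p q))

  answer : ℕ → Code
  answer k = ifz k zeroC (compC succC zeroC)

  -- The choice is between indices and not between values, so that φ_s(y) is not evaluated when y <
  -- c, where it may diverge.
  consult : ℕ → ℕ → ℕ → ℕ → ℕ
  consult ε y s c = ifz (c ∸ y) s (encode (answer (bit ε y)))

  consultᶜ : Computable (λ w → consult (π₁ (π₁ w)) (π₂ (π₁ w)) (π₁ (π₂ w)) (π₂ (π₂ w)))
  consultᶜ = ifzᶜ (∸ᶜ (sndᶜ (sndᶜ idᶜ)) y) (fstᶜ (sndᶜ idᶜ))
    (comp-cong (λ w → eq (bit (π₁ (π₁ w)) (π₂ (π₁ w))))
      (ifzᶜ (bitᶜ (fstᶜ (fstᶜ idᶜ)) y)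
        (constᶜ (encode zeroC)) (constᶜ (encode (compC succC zeroC)))))
    where
    y = sndᶜ (fstᶜ idᶜ)
    eq : ∀ k → ifz k (encode zeroC) (encode (compC succC zeroC)) ≡ encode (answer k)
    eq zero    = refl
    eq (suc _) = refl

  -- The run takes 1 + ⟪ ε , y ⟫ steps, which exceeds y and all elements of ε.
  opaque
    conjecture : Code
    conjecture = compC universal
      (pairC (compC (proj₁ consultᶜ) (pairC idC (compC trajectory (pairC fstC succC)))) sndC)

    ev-conjecture : ∀ {ε y s c v} → Run (symbol (bit ε)) (suc ⟪ ε , y ⟫) s c →
                    φ (consult ε y s c) y v → Eval conjecture ⟪ ε , y ⟫ v
    ev-conjecture {ε} {y} {s} {c} r p = ev-comp
      (ev-⟪⟫ (ev-comp (ev-⟪⟫ (ev-id z)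
               (ev-comp (ev-⟪⟫ (subst (Eval fstC z) (π₁-⟪⟫ ε y) (ev-π₁ z)) (ev-succ z))
                        (ev-trajectory r)))
               (subst (Eval (proj₁ consultᶜ) ⟪ z , ⟪ s , c ⟫ ⟫) consult≡ (proj₂ consultᶜ _)))
             (subst (Eval sndC z) (π₂-⟪⟫ ε y) (ev-π₂ z)))
      (ev-universal p)
      where
      z : ℕ
      z = ⟪ ε , y ⟫
      consult≡ : consult (π₁ (π₁ ⟪ z , ⟪ s , c ⟫ ⟫)) (π₂ (π₁ ⟪ z , ⟪ s , c ⟫ ⟫))
                         (π₁ (π₂ ⟪ z , ⟪ s , c ⟫ ⟫)) (π₂ (π₂ ⟪ z , ⟪ s , c ⟫ ⟫)) ≡ consult ε y s c
      consult≡ rewrite π₁-⟪⟫ z ⟪ s , c ⟫ | π₂-⟪⟫ z ⟪ s , c ⟫ | π₁-⟪⟫ ε y | π₂-⟪⟫ ε y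
                     | π₁-⟪⟫ s c | π₂-⟪⟫ s c = refl

  opaque
    -- An instance of the s-m-n function: ε is stored in the program as a numeral. Being total, it
    -- leaves the run of `h` as the only source of divergence in the learner.
    index : ℕ → ℕ
    index ε = ⌜ compC conjecture (pairC (numeral ε) idC) ⌝

    φ-index : ∀ {ε y v} → Eval conjecture ⟪ ε , y ⟫ v → φ (index ε) y v
    φ-index {ε} {y} d = _ , encode≡⌜⌝ (compC conjecture (pairC (numeral ε) idC)) ,
                        ev-comp (ev-⟪⟫ (ev-numeral ε y) (ev-id y)) d

    indexᶜ : Computable index
    -- 5 and 6 are the tags of `compC` and `pairC`.
    indexᶜ = ⟪ constᶜ 5 , ⟪ constᶜ ⌜ conjecture ⌝ ,
               ⟪ constᶜ 6 , ⟪ numeralᶜ , constᶜ ⌜ idC ⌝ ⟫ᶜ ⟫ᶜ ⟫ᶜ ⟫ᶜ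
      where
      numeralᶜ : Computable (λ ε → ⌜ numeral ε ⌝)
      numeralᶜ = comp-cong eq (recᶜ {g = λ _ _ u → ⟪ 5 , ⟪ ⌜ succC ⌝ , u ⟫ ⟫} (constᶜ ⌜ zeroC ⌝)
        ⟪ constᶜ 5 , ⟪ constᶜ ⌜ succC ⌝ , sndᶜ (sndᶜ idᶜ) ⟫ᶜ ⟫ᶜ idᶜ)
        where
        eq : ∀ n → natrec ⌜ zeroC ⌝ (λ _ u → ⟪ 5 , ⟪ ⌜ succC ⌝ , u ⟫ ⟫) n ≡ ⌜ numeral n ⌝
        eq zero    = refl
        eq (suc n) = cong (λ u → ⟪ 5 , ⟪ ⌜ succC ⌝ , u ⟫ ⟫) (eq n)

  -- The truncation is the code of D ∩ [0,c), where d codes D.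
  hypothesis : ℕ → ℕ → ℕ
  hypothesis d c = index (binary (bit d) c)

  hypothesisᶜ : Computable (λ z → hypothesis (π₁ z) (π₂ z))
  hypothesisᶜ = indexᶜ ∘ᶜ truncateᶜ (fstᶜ idᶜ) (sndᶜ idᶜ)

  -- The code d of a finite set exceeds its elements, so d steps exhaust the set.
  opaque
    learner : Code
    learner = compC (proj₁ hypothesisᶜ)
      (pairC idC (compC sndC (compC trajectory (pairC idC idC))))

    ev-learner : ∀ {d s c} → Run (symbol (bit d)) d s c → Eval learner d (hypothesis d c)
    ev-learner {d} {s} {c} r = ev-comp
      (ev-⟪⟫ (ev-id d) (ev-comp (ev-comp (ev-⟪⟫ (ev-id d) (ev-id d)) (ev-trajectory r))
        (subst (Eval sndC ⟪ s , c ⟫) (π₂-⟪⟫ s c) (ev-π₂ _))))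
      (subst (Eval (proj₁ hypothesisᶜ) ⟪ d , c ⟫) (cong₂ hypothesis (π₁-⟪⟫ d c) (π₂-⟪⟫ d c))
        (proj₂ hypothesisᶜ _))

  -- Finite runs as beginnings of texts

  It-det : ∀ {T} n {u v} → It h T n u → It h T n v → u ≡ v
  It-det zero    d d′ = Eval-det refl d d′
  It-det {T} (suc n) (u , p , d) (u′ , p′ , d′) with refl ← It-det {T} n p p′ = Eval-det refl d d′

  -- One step of a run consumes two entries of the padded text, hence the position `n * 2`.
  It⇒Run : ∀ {a} n {s} → It h (padded a) (n * 2) s → ∃[ c ] Run a n s c
  It⇒Run zero d = 0 , start d
  It⇒Run {a} (suc n) {v} (u , (s , p , d) , e) with _ , r ← It⇒Run n p =
    Run-suc r (subst (λ m → Next s m u) (padded-even a n) d)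
              (subst (λ m → Next u m v) (padded-odd a n) e)

  extension : ℕ → (ℕ → ℕ) → Text → Text
  extension n b T = padded (splice n (symbol b) T)

  Within : (ℕ → ℕ) → Text → Set
  Within b T = ∀ x → b x ≢ 0 → content T x

  extension-same : ∀ n {b T} → Within b T → SameLang (content (extension n b T)) (content T)
  extension-same n {b} {T} within = SameLang-trans (content-padded _) (content-splice n sub)
    where
    sub : ∀ {x} → content (symbol b) x → content T x
    sub {x} (i , eq) with refl , b≢0 ← symbol-just {b} {i} eq = within x b≢0

  extension-Run : ∀ n {b T s} → It h (extension n b T) (n * 2) s → ∃[ c ] Run (symbol b) n s c
  extension-Run n {b} {T} p with c , r ← It⇒Run n p = c , Run-cong (splice-< (symbol b) T) r

  within-seen : ∀ T i → Within (bit (setCode (seen T i))) T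
  within-seen T i x bit≢0 with bit-setCode (seen T i) x
  ... | inj₁ (x∈ , _)   = ∈-seen⁻ i x∈
  ... | inj₂ (_ , bit≡0) = contradiction bit≡0 bit≢0

  within-truncate : ∀ {b T} c → Within b T → Within (bit (binary b c)) T
  within-truncate {b} c within x bit≢0 with x <? c
  ... | no x≮c = contradiction (bit-binary-≥ b c x (≮⇒≥ x≮c)) bit≢0
  ... | yes x<c = within x λ b≡0 →
    bit≢0 (trans (bit-binary-< b c x x<c) (cong (λ k → ifz k 0 1) b≡0))

  φ-answer : ∀ k y → φ (encode (answer k)) y (ifz k 0 1)
  φ-answer zero    y = zeroC , refl , ev-zero y
  φ-answer (suc _) y = compC succC zeroC , refl , ev-comp (ev-zero y) (ev-succ 0)

  ifz-01≤1 : ∀ k → ifz k 0 1 ≤ 1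
  ifz-01≤1 zero    = z≤n
  ifz-01≤1 (suc _) = ≤-refl

  consult-CIndex : ∀ ε y s c → CIndex s → ∃ λ v → φ (consult ε y s c) y v × v ≤ 1
  consult-CIndex ε y s c total with c ∸ y
  ... | zero  = total y
  ... | suc _ = _ , φ-answer (bit ε y) y , ifz-01≤1 (bit ε y)

  -- The answer on `y` rests on a finite run over ε, which begins a text with the content of `T`; so
  -- the run is defined and ends in a C-index s. Although s may vary with `y`, both φ_s(y) and the
  -- remembered bit are at most 1.
  index-CIndex : ∀ {T ε} → (∀ T′ → SameLang (content T′) (content T) → holds CInd (It h T′) T′) →
                 Within (bit ε) T → CIndex (index ε)
  index-CIndex {T} {ε} cind within y
    with s , p , total ← cind (extension (suc ⟪ ε , y ⟫) (bit ε) T)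
                              (extension-same (suc ⟪ ε , y ⟫) within) (suc ⟪ ε , y ⟫ * 2)
    with c , r ← extension-Run (suc ⟪ ε , y ⟫) {T = T} p
    with v , d , v≤1 ← consult-CIndex ε y s c total =
    v , φ-index (ev-conjecture r d) , v≤1

  -- The run over the set seen so far begins a text with the content of `T` and is therefore
  -- defined. Truncating the set keeps it inside that content, so `index-CIndex` applies.
  learner-CInd : ∀ {T} → (∀ T′ → SameLang (content T′) (content T) → holds CInd (It h T′) T′) →
                 holds CInd (Sd learner T) T
  learner-CInd {T} cind i = emit (setCode (seen T i)) (within-seen T i)
    where
    emit : ∀ d → Within (bit d) T → ∃ λ v → Eval learner d v × CIndex v
    emit d within with s , p , _ ← cind (extension d (bit d) T) (extension-same d within) (d * 2)
      with c , r ← extension-Run d {T = T} p =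
      hypothesis d c , ev-learner r , index-CIndex cind (within-truncate c within)

  -- Convergence of the set-driven learner

  -- The data come from `h` on the increasing padded text of the language: by place `n₀` it has
  -- reached its final hypothesis `e`, which later elements and pauses preserve, and `k` is the
  -- place from which `e` is held.
  module Limit {T : Text} {ℓ : ℕ → ℕ} (decides : Decides ℓ (content T))
               {n₀ e k : ℕ} (settling : Run (symbol ℓ) n₀ e k) (pause : Next e nothing e)
               (read-stable : ∀ n → n₀ ≤ n → Next e (symbol ℓ n) e)
               (φ-e : ∀ y → φ e y (ℓ y)) where

    k≤n₀ : k ≤ n₀
    k≤n₀ = Run-≤ settling

    limit : ℕ
    limit = binary ℓ k

    -- Up to `n₀` the run is that on the whole language. After `n₀` each place holds either an
    -- element of the language or a pause, and `e` survives both.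
    settled-subset : ∀ {b} → (∀ j → j < n₀ → b j ≡ ℓ j) → (∀ j → b j ≡ ℓ j ⊎ b j ≡ 0) →
                     ∀ n → k ≤ n → Run (symbol b) n e k
    settled-subset {b} agrees subset n k≤n = by-cases (≤-total n n₀)
      where
      settling′ : Run (symbol b) n₀ e k
      settling′ = Run-cong (λ j j<n₀ → cong (cell j) (sym (agrees j j<n₀))) settling
      unmoved : ∀ j → n₀ ≤ j → Next e (symbol b j) e
      unmoved j n₀≤j with subset j
      ... | inj₁ b≡ℓ = subst (λ m → Next e m e) (cong (cell j) (sym b≡ℓ)) (read-stable j n₀≤j)
      ... | inj₂ b≡0 = subst (λ m → Next e m e) (cong (cell j) (sym b≡0)) pause
      by-cases : n ≤ n₀ ⊎ n₀ ≤ n → Run (symbol b) n e k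
      by-cases (inj₁ n≤n₀) = Run-since n k≤n n≤n₀ settling′
      by-cases (inj₂ n₀≤n) = Run-extend n (≤⇒≤′ n₀≤n) settling′ pause unmoved

    ifz-ℓ : ∀ y → ifz (ℓ y) 0 1 ≡ ℓ y
    ifz-ℓ y with decides y
    ... | inj₁ (ℓ≡1 , _) rewrite ℓ≡1 = refl
    ... | inj₂ (ℓ≡0 , _) rewrite ℓ≡0 = refl

    bit-limit : ∀ j → j < k → bit limit j ≡ ℓ j
    bit-limit j j<k = trans (bit-binary-< ℓ k j j<k) (ifz-ℓ j)

    -- `limit` need not agree with the language between `k` and `n₀`, but from `k` on the run has
    -- settled on `e` and meets pauses only.
    settled-limit : ∀ n → k ≤ n → Run (symbol (bit limit)) n e k
    settled-limit n k≤n = Run-extend-pauses n k≤n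
      (Run-cong (λ j j<k → cong (cell j) (sym (bit-limit j j<k)))
        (Run-since k ≤-refl k≤n₀ settling))
      pause (λ j k≤j → cong (cell j) (bit-binary-≥ ℓ k j k≤j))

    -- The rerun over `limit` is long enough to exhaust it. Either it passes `k` and recovers `e`
    -- and `k`, or it stops earlier with its last change at its very end, beyond `y`; then memory
    -- answers, correctly since `y` is below `k`.
    φ-limit : ∀ y → φ (index limit) y (ℓ y)
    φ-limit y with Run-exhausted (suc ⟪ limit , y ⟫) settled-limit
      (λ j N≤j → cong (cell j)
        (bit-≥ limit j (≤-trans (x≤⟪x,y⟫ limit y) (<⇒≤ N≤j))))
    ... | s , c , r , position = φ-index (ev-conjecture r (consulted position))
      where
      -- The bound by `c` selects the memory branch; the bound by `k` makes the remembered bit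
      -- correct.
      remembered : ∀ s c → y < c → y < k → φ (consult limit y s c) y (ℓ y)
      remembered s c y<c y<k with c ∸ y | m<n⇒0<n∸m y<c
      ... | suc _ | _ = subst (φ _ y) (trans (cong (λ b → ifz b 0 1) (bit-limit y y<k)) (ifz-ℓ y))
                          (φ-answer (bit limit y) y)
      consulted : (k ≤ suc ⟪ limit , y ⟫ × s ≡ e × c ≡ k) ⊎
                  (suc ⟪ limit , y ⟫ < k × c ≡ suc ⟪ limit , y ⟫) →
                  φ (consult limit y s c) y (ℓ y)
      consulted (inj₂ (N<k , refl)) = remembered s c (s≤s (y≤⟪x,y⟫ limit y))
        (<-trans (s≤s (y≤⟪x,y⟫ limit y)) N<k)
      consulted (inj₁ (_ , refl , refl)) with k ≤? y
      ... | no k≰y = remembered e k (≰⇒> k≰y) (≰⇒> k≰y)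
      ... | yes k≤y rewrite m≤n⇒m∸n≡0 k≤y = φ-e y

    -- If the run of length d reaches `k`, the set is cut at `k`, where it agrees with the language.
    -- If d < k, the cut at d removes nothing, as all elements are below d; the whole set is then
    -- the part of the language below `k`.
    ev-learner-limit : ∀ {d} → (∀ j → j < n₀ → bit d j ≡ ℓ j) →
                       (∀ j → bit d j ≡ ℓ j ⊎ bit d j ≡ 0) → Eval learner d (index limit)
    ev-learner-limit {d} agrees subset
      with Run-exhausted d (settled-subset agrees subset)
             (λ j d≤j → cong (cell j) (bit-≥ d j d≤j))
    ... | s , c , r , position =
      subst (Eval learner d) (cong index (truncated position)) (ev-learner r)
      where
      truncated : (k ≤ d × s ≡ e × c ≡ k) ⊎ (d < k × c ≡ d) → binary (bit d) c ≡ limit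
      truncated (inj₁ (_ , _ , refl)) = binary-cong k λ j j<k → agrees j (<-≤-trans j<k k≤n₀)
      truncated (inj₂ (d<k , refl))   = trans
        (sym (binary-extend k (≤⇒≤′ (<⇒≤ d<k)) (bit-≥ d)))
        (binary-cong k λ j j<k → agrees j (<-≤-trans j<k k≤n₀))

    learner-limit : ∃[ i₀ ] ∀ i → i₀ ≤ i → Sd learner T i (index limit)
    learner-limit with eventually-seen decides n₀
    ... | i₀ , now = i₀ , λ i i₀≤i → ev-learner-limit (agrees i i₀≤i) (subset i)
      where
      agrees : ∀ i → i₀ ≤ i → ∀ j → j < n₀ → bit (setCode (seen T i)) j ≡ ℓ j
      agrees i i₀≤i j j<n₀ with bit-setCode (seen T i) j | decides j
      ... | inj₁ (_ , bit≡1) | inj₁ (ℓ≡1 , _) = trans bit≡1 (sym ℓ≡1)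
      ... | inj₂ (_ , bit≡0) | inj₂ (ℓ≡0 , _) = trans bit≡0 (sym ℓ≡0)
      ... | inj₁ (j∈ , _)    | inj₂ (_ , j∉T) = contradiction (∈-seen⁻ i j∈) j∉T
      ... | inj₂ (j∉ , _)    | inj₁ (_ , j∈T) = contradiction (now i i₀≤i j j<n₀ j∈T) j∉
      subset : ∀ i j → bit (setCode (seen T i)) j ≡ ℓ j ⊎ bit (setCode (seen T i)) j ≡ 0
      subset i j with bit-setCode (seen T i) j | decides j
      ... | inj₂ (_ , bit≡0) | _              = inj₂ bit≡0
      ... | inj₁ (_ , bit≡1) | inj₁ (ℓ≡1 , _) = inj₁ (trans bit≡1 (sym ℓ≡1))
      ... | inj₁ (j∈ , _)    | inj₂ (_ , j∉T) = contradiction (∈-seen⁻ i j∈) j∉T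

    learner-ExC : ExC (Sd learner T) T
    learner-ExC with i₀ , converges ← learner-limit =
      i₀ , index limit , converges , decides-φ decides φ-limit

  -- The characteristic function makes the increasing padded text available as a function, and the
  -- convergence of `h` on this single text supplies all that `Limit` asks for.
  learner-ExC : ∀ {T ℓ} → Decides ℓ (content T) →
                (∀ T′ → SameLang (content T′) (content T) → ExC (It h T′) T′) →
                ExC (Sd learner T) T
  learner-ExC {T} {ℓ} decides learns = from-ExC (learns text canonical)
    where
    text : Text
    text = padded (symbol ℓ)
    n≤n*2 : ∀ n → n ≤ n * 2
    n≤n*2 n = m≤m*n n 2
    symbols : SameLang (content (symbol ℓ)) (content T)
    symbols x = to , from
      where
      to : content (symbol ℓ) x → content T x
      to (i , eq) with refl , ℓ≢0 ← symbol-just {ℓ} {i} eq with decides i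
      ... | inj₁ (_ , i∈T) = i∈T
      ... | inj₂ (ℓ≡0 , _) = contradiction ℓ≡0 ℓ≢0
      from : content T x → content (symbol ℓ) x
      from x∈T with decides x
      ... | inj₁ (ℓ≡1 , _) = x , cong (cell x) ℓ≡1
      ... | inj₂ (_ , x∉T) = contradiction x∈T x∉T
    canonical : SameLang (content text) (content T)
    canonical = SameLang-trans (content-padded _) symbols
    from-ExC : ExC (It h text) text → ExC (Sd learner T) T
    from-ExC (n₀ , e , converged , total , same) = Limit.learner-ExC decides
      -- Place `n₀` of the unpadded text lies at position n₀ * 2, which is at least `n₀`, so `h` has
      -- converged there.
      (proj₂ (It⇒Run n₀ (converged (n₀ * 2) (n≤n*2 n₀))))
      (subst (λ m → Next e m e) (padded-odd (symbol ℓ) n₀)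
        (stable (suc (n₀ * 2)) (m≤n⇒m≤1+n (n≤n*2 n₀))))
      (λ n n₀≤n → subst (λ m → Next e m e) (padded-even (symbol ℓ) n)
        (stable (n * 2) (≤-trans n₀≤n (n≤n*2 n))))
      (φ-decides total (SameLang-trans same canonical) decides)
      where
      stable : ∀ n → n₀ ≤ n → Next e (text n) e
      stable n n₀≤n with u , p , d ← converged (suc n) (m≤n⇒m≤1+n n₀≤n)
        with refl ← It-det {text} n p (converged n n₀≤n) = d

  learner-total : (∀ x → ∃ λ y → Eval h x y) → ∀ x → ∃ λ y → Eval learner x y
  learner-total total d with s , c , r ← Run-total total (symbol (bit d)) d =
    hypothesis d c , ev-learner r

-- Transfer of the restrictions and of the class of the learner

-- Asking for `α` only on texts with the content of `T` serves both restrictions: the global one for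
-- arbitrary `T`, and the local one for texts of a learned language.
learner-holds : ∀ h α {T} → (∀ T′ → SameLang (content T′) (content T) → holds α (It h T′) T′) →
                holds α (Sd (Simulation.learner h) T) T
learner-holds h CInd = Simulation.learner-CInd h
learner-holds h Tr _ = _

learner-InLClass : ∀ h 𝓒 → InLClass 𝓒 h → InLClass 𝓒 (Simulation.learner h)
learner-InLClass h 𝓡 = Simulation.learner-total h
learner-InLClass h 𝓟 _ = _

Decides-cong : ∀ {ℓ L M} → SameLang L M → Decides ℓ L → Decides ℓ M
Decides-cong same decides x with decides x
... | inj₁ (ℓ≡1 , Lx)  = inj₁ (ℓ≡1 , proj₁ (same x) Lx)
... | inj₂ (ℓ≡0 , ¬Lx) = inj₂ (ℓ≡0 , ¬Lx ∘ proj₂ (same x))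

theorem4 : (δ δ′ : Restr) (𝓒 : LClass) (𝓛 : Lang → Set) →
    InLearnable δ′ 𝓒 It δ 𝓛 → InLearnable δ′ 𝓒 Sd δ 𝓛
theorem4 δ δ′ 𝓒 𝓛 (recursive , h , h∈𝓒 , learns) =
  recursive , Simulation.learner h , learner-InLClass h 𝓒 h∈𝓒 , λ L L∈𝓛 →
    let always , onTexts = learns L L∈𝓛
        ℓ , decides      = recursive⇒decides (recursive L L∈𝓛)
    in (λ T → learner-holds h δ′ λ T′ _ → always T′) ,
       (λ T T-for-L →
          learner-holds h δ (λ T′ same → proj₁ (onTexts T′ (SameLang-trans same T-for-L))) ,
          Simulation.learner-ExC h (Decides-cong (SameLang-sym T-for-L) decides)
            (λ T′ same → proj₂ (onTexts T′ (SameLang-trans same T-for-L))))
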